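{- For every positive integer $n$, $$\sum_{b\in B_n^{(1,2)}} u^{\deg_\theta(b)} v^{\deg_\xi(b)} q^{\deg_x(b)}\, Q_{\mathrm{Asc}(b),n} \;=\; \sum_{\substack{k,\ell\ge0\\ k+\ell<n}} u^k v^\ell \sum_{\sigma\in \mathrm{SW}(1^n,k,\ell)} q^{\mathrm{sminv}(\sigma)}\, Q_{\mathrm{Split}(\sigma),n}.$$
   Context: **Fundamental quasisymmetric functions.** For $S\subseteq\{1,\ldots,n-1\}$, $Q_{S,n}=\sum z_{a_1}z_{a_2}\cdots z_{a_n}$, summed over $a_1\le a_2\le\cdots\le a_n$ (positive integers) with $a_i<a_{i+1}$ whenever $i\in S$. **The set $B_n^{(1,2)}$.** A modified Motzkin path of length $n$ is a lattice path $\pi=(p_1,\ldots,p_n)$ in $\mathbb{Z}^2$ starting at $(0,0)$ whose $i$-th step $p_i$ is one of: an (undecorated) up-step $(1,1)$; a horizontal step $(1,0)$ with decoration $\theta_i$; a horizontal step $(1,0)$ with decoration $\xi_i$; a down-step $(1,-1)$ with decoration $\theta_i\xi_i$; such that the first step is an up-step and afterwards the path never goes below the line $y=1$. The set of these paths is $\Pi(n)_{>0}$. For $\pi\in\Pi(n)_{>0}$ let $T(\pi)$ (resp. $S(\pi)$) be the set of indices $i$ such that $\theta_i$ (resp. $\xi_i$) occurs in the decoration of $p_i$; both are subsets of $\{2,\ldots,n\}$. For $T,S\subseteq\{2,\ldots,n\}$ define $\alpha(T,S)$ by $\alpha_1(T,S)=0$ and, for $2\le i\le n$, $\alpha_i(T,S)=\alpha_{i-1}(T,S)-1+\chi(i\notin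 T)+\chi(i\notin S)$, where $\chi(P)=1$ if $P$ is true and $0$ otherwise. $B_n^{(1,2)}$ is the set of monomials $x^\alpha\theta_T\xi_S$ (with $x_i$ commuting, $\theta_i,\xi_i$ anticommuting variables, $\theta_T,\xi_S$ the products in increasing order of indices) such that $(T,S)=(T(\pi),S(\pi))$ for some $\pi\in\Pi(n)_{>0}$ and $0\le\alpha_i\le\alpha_i(T,S)$ for all $i$. Signs are irrelevant: we write $b=\pm\prod_{i=1}^n x_i^{\alpha_i}\theta_i^{\beta_i}\xi_i^{\gamma_i}$ with $\alpha_i\in\mathbb{Z}_{\ge0}$, $\beta_i,\gamma_i\in\{0,1\}$, and $\deg_x(b)=\sum\alpha_i$, $\deg_\theta(b)=\sum\beta_i$, $\deg_\xi(b)=\sum\gamma_i$. **Ascents of $b$.** An index $i\in\{1,\ldots,n-1\}$ is an ascent of $b$ iff one of: $\beta_i<\beta_{i+1}$; or $\beta_i=\beta_{i+1}=1$ and $\alpha_i\ge\alpha_{i+1}+\gamma_{i+1}$; or $\beta_i=\beta_{i+1}=0$ and $\alpha_i<\alpha_{i+1}+\gamma_{i+1}$. $\mathrm{Asc}(b)$ is the set of ascents of $b$. **Segmented permutations.** A segmented permutation of length $n$ is a permutation $\sigma_1\cdots\sigma_n$ of $\{1,\ldots,n\}$ cut into consecutive nonempty blocks. An ascent (resp. descent) of $\sigma$ is an index $i$ such that $\sigma_i,\sigma_{i+1}$ lie in the same block and $\sigma_i<\sigma_{i+1}$ (resp. $\sigma_i>\sigma_{i+1}$). $\mathrm{SW}(1^n,k,\ell)$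 is the set of segmented permutations of length $n$ with exactly $k$ ascents and $\ell$ descents. A sminversion of $\sigma$ is a pair $(i,j)$ with $1\le i<j\le n$, $\sigma_i>\sigma_j$, and either $\sigma_j$ is the first letter of its block or $\sigma_{j-1}>\sigma_i$; $\mathrm{sminv}(\sigma)$ is the number of sminversions. **Split.** An index $i$ is thick for $\sigma$ if it is the first position of its block or $\sigma_{i-1}>\sigma_i$; it is thin if it is not the first position of its block and $\sigma_{i-1}<\sigma_i$. A value $m=\sigma_i<n$, with $j$ defined by $\sigma_j=m+1$, is splitting for $\sigma$ if: $i$ is thick and $j$ is thin; or $i,j$ are both thin and $i<j$; or $i,j$ are both thick and $j<i$. $\mathrm{Split}(\sigma)$ is the set of $m\in\{1,\ldots,n-1\}$ that are splitting for $\sigma$. -}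

module Defs where

open import Data.Bool.Base using (true; false; if_then_else_)
open import Data.Empty using (⊥)
open import Data.Fin.Base as Fin using (Fin; zero; suc; inject₁)
import Data.Fin.Properties as Fin
open import Data.Fin.Subset using (Subset; Side; inside; outside; ∣_∣; _∈_; _∉_)
open import Data.Fin.Subset.Properties using (_∈?_)
open import Data.Integer.Base as ℤ using (ℤ; +_; -[1+_]; 0ℤ; 1ℤ; -1ℤ)
import Data.Integer.Properties as ℤ
open import Data.List.Base as List using (List; []; _∷_; _++_; length; filter; cartesianProduct; allFin; upTo)
import Data.List.Membership.Propositional as List
import Data.List.Membership.Propositional.Properties as List
import Data.List.Relation.Unary.All as All
import Data.List.Relation.Unary.AllPairs as AllPairs
open import Data.List.Relation.Unary.Any using (here; there)
open import Data.List.Relation.Unary.Unique.Propositional using (Unique)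
import Data.List.Relation.Unary.Unique.Propositional.Properties as Unique
open import Data.Nat.Base as ℕ using (ℕ; zero; suc; _+_; _<_; _≤_; _≥_; s≤s)
import Data.Nat.ListAction as ListAction
import Data.Nat.Properties as ℕ
open import Data.Product.Base using (∃; _×_; _,_; proj₁; proj₂; uncurry)
open import Data.Sum.Base using (_⊎_; inj₁; inj₂)
open import Data.Unit.Base using (⊤; tt)
open import Data.Vec.Base as Vec using (Vec; []; _∷_; head; lookup; tabulate)
import Data.Vec.Properties as Vec
open import Data.Vec.Relation.Binary.Pointwise.Inductive using (Pointwise; []; _∷_)
import Data.Vec.Relation.Unary.All as VecAll
open import Function.Base using (_∘_)
open import Function.Consequences.Propositional using (strictlySurjective⇒surjective; surjective⇒strictlySurjective)
open import Function.Definitions using (Bijective)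
open import Relation.Binary.PropositionalEquality using (_≡_; refl; cong; cong₂)
open import Relation.Nullary.Decidable using (Dec; yes; no; does; map′; _×-dec_; _⊎-dec_; _→-dec_; ¬?)
open import Relation.Nullary.Negation using (¬_)
open import Relation.Unary using (Pred; Decidable)
open import Level using (0ℓ)

-- Finite sets, given by a predicate together with a repetition-free list
-- of exactly the elements that satisfy it.

record Enumeration {A : Set} (P : Pred A 0ℓ) : Set where
  field
    elements : List A
    unique   : Unique elements
    sound    : ∀ {x} → x List.∈ elements → P x
    complete : ∀ {x} → P x → x List.∈ elements

open Enumeration public

Finite : Set → Set
Finite A = Enumeration {A} (λ _ → ⊤)

restrict : ∀ {A : Set} {P Q : Pred A 0ℓ} → Enumeration P → Decidable Q →
           Enumeration (λ x → P x × Q x)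
restrict X Q? = record
  { elements = filter Q? (elements X)
  ; unique   = Unique.filter⁺ Q? (unique X)
  ; sound    = λ x∈ → let x∈X , qx = List.∈-filter⁻ Q? x∈ in sound X x∈X , qx
  ; complete = λ (px , qx) → List.∈-filter⁺ Q? (complete X px) qx
  }

equiv : ∀ {A : Set} {P Q : Pred A 0ℓ} → Enumeration P →
        (∀ {x} → P x → Q x) → (∀ {x} → Q x → P x) → Enumeration Q
equiv X to from = record
  { elements = elements X
  ; unique   = unique X
  ; sound    = to ∘ sound X
  ; complete = complete X ∘ from
  }

select : ∀ {A : Set} {P : Pred A 0ℓ} → Finite A → Decidable P → Enumeration P
select A P? = equiv (restrict A P?) proj₂ (tt ,_)

image : ∀ {A B : Set} {P : Pred A 0ℓ} (f : A → B) → (∀ {x y} → f x ≡ f y → x ≡ y) →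
        Enumeration P → Enumeration (λ y → ∃ λ x → P x × y ≡ f x)
image f f-inj X = record
  { elements = List.map f (elements X)
  ; unique   = Unique.map⁺ f-inj (unique X)
  ; sound    = λ y∈ → let x , x∈X , y≡ = List.∈-map⁻ f y∈ in x , sound X x∈X , y≡
  ; complete = λ { (x , px , refl) → List.∈-map⁺ f (complete X px) }
  }

product : ∀ {A B : Set} {P : Pred A 0ℓ} {Q : Pred B 0ℓ} →
          Enumeration P → Enumeration Q → Enumeration (λ ((x , y) : A × B) → P x × Q y)
product X Y = record
  { elements = cartesianProduct (elements X) (elements Y)
  ; unique   = Unique.cartesianProduct⁺ (unique X) (unique Y)
  ; sound    = λ xy∈ → let x∈ , y∈ = List.∈-cartesianProduct⁻ (elements X) (elements Y) xy∈
                       in sound X x∈ , sound Y y∈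
  ; complete = λ (px , qy) → List.∈-cartesianProduct⁺ (complete X px) (complete Y qy)
  }

module _ {A B : Set} {Q : A → Pred B 0ℓ} (Y : ∀ x → Enumeration (Q x)) where

  private
    pairs : List A → List (A × B)
    pairs []       = []
    pairs (x ∷ xs) = List.map (x ,_) (elements (Y x)) ++ pairs xs

    pairs-sound : ∀ xs {x y} → (x , y) List.∈ pairs xs → x List.∈ xs × Q x y
    pairs-sound (z ∷ xs) p with List.∈-++⁻ (List.map (z ,_) (elements (Y z))) p
    ... | inj₁ q with y , y∈ , refl ← List.∈-map⁻ (z ,_) q = here refl , sound (Y z) y∈
    ... | inj₂ q = let x∈ , qy = pairs-sound xs q in there x∈ , qy

    pairs-complete : ∀ {xs x y} → x List.∈ xs → Q x y → (x , y) List.∈ pairs xs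
    pairs-complete {z ∷ _} (here refl) qy =
      List.∈-++⁺ˡ (List.∈-map⁺ (z ,_) (complete (Y z) qy))
    pairs-complete {z ∷ _} (there x∈) qy =
      List.∈-++⁺ʳ (List.map (z ,_) (elements (Y z))) (pairs-complete x∈ qy)

    pairs-unique : ∀ {xs} → Unique xs → Unique (pairs xs)
    pairs-unique {[]}     AllPairs.[] = AllPairs.[]
    pairs-unique {z ∷ xs} u@(_ AllPairs.∷ us) =
      Unique.++⁺ (Unique.map⁺ (cong proj₂) (unique (Y z))) (pairs-unique us) disjoint
      where
      disjoint : ∀ {p} → ¬ (p List.∈ List.map (z ,_) (elements (Y z)) × p List.∈ pairs xs)
      disjoint (p∈ , p∈′) with _ , _ , refl ← List.∈-map⁻ (z ,_) p∈ =
        Unique.Unique[x∷xs]⇒x∉xs u (proj₁ (pairs-sound xs p∈′))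

  dependentProduct : ∀ {P : Pred A 0ℓ} → Enumeration P →
                     Enumeration (λ ((x , y) : A × B) → P x × Q x y)
  dependentProduct X = record
    { elements = pairs (elements X)
    ; unique   = pairs-unique (unique X)
    ; sound    = λ p → let x∈ , qy = pairs-sound (elements X) p in sound X x∈ , qy
    ; complete = λ (px , qy) → pairs-complete (complete X px) qy
    }

finiteFin : ∀ n → Finite (Fin n)
finiteFin n = record
  { elements = allFin n
  ; unique   = Unique.allFin⁺ n
  ; sound    = λ _ → tt
  ; complete = λ {i} _ → List.∈-allFin i
  }

finitePair : ∀ {n} → Finite (Fin n × Fin n)
finitePair {n} = equiv (product (finiteFin n) (finiteFin n)) (λ _ → tt) (λ _ → tt , tt)

below : ∀ n → Enumeration (_< n)
below n = record
  { elements = upTo n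
  ; unique   = Unique.upTo⁺ n
  ; sound    = List.∈-upTo⁻
  ; complete = List.∈-upTo⁺
  }

finiteSide : Finite Side
finiteSide = record
  { elements = inside ∷ outside ∷ []
  ; unique   = ((λ ()) All.∷ All.[]) AllPairs.∷ (All.[] AllPairs.∷ AllPairs.[])
  ; sound    = λ _ → tt
  ; complete = λ { {true} _ → here refl ; {false} _ → there (here refl) }
  }

cons : ∀ {A : Set} {n} → A × Vec A n → Vec A (suc n)
cons (x , xs) = x ∷ xs

cons-inj : ∀ {A : Set} {n} {p q : A × Vec A n} → cons p ≡ cons q → p ≡ q
cons-inj refl = refl

singleton-[] : ∀ {A : Set} {P : Pred (Vec A 0) 0ℓ} → P [] → Enumeration P
singleton-[] p = record
  { elements = [] ∷ []
  ; unique   = All.[] AllPairs.∷ AllPairs.[]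
  ; sound    = λ { (here refl) → p }
  ; complete = λ { {[]} _ → here refl }
  }

finiteVec : ∀ {A : Set} → Finite A → ∀ n → Finite (Vec A n)
finiteVec A zero    = singleton-[] tt
finiteVec A (suc n) = equiv (image cons cons-inj (product A (finiteVec A n)))
  (λ _ → tt) (λ { {x ∷ xs} _ → (x , xs) , (tt , tt) , refl })

-- Formal power series in u, v, q, z₁, z₂, … with coefficients in ℕ.
-- A monomial z₁^c₁ z₂^c₂ ⋯ is given by the list c₁ ∷ c₂ ∷ ⋯ of its
-- exponents, the exponents beyond the end of the list being 0.

ZMonomial : Set
ZMonomial = List ℕ

-- F i j k c is the coefficient of u^i v^j q^k z^c in F.
Series : Set
Series = ℕ → ℕ → ℕ → ZMonomial → ℕ

infix 4 _≈_
_≈_ : Series → Series → Set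
F ≈ G = ∀ i j k c → F i j k c ≡ G i j k c

infixr 7 u^_·_ v^_·_ q^_·_

u^_·_ v^_·_ q^_·_ : ℕ → Series → Series
(u^ zero  · F) i       j k c = F i j k c
(u^ suc a · F) zero    j k c = 0
(u^ suc a · F) (suc i) j k c = (u^ a · F) i j k c
(v^ zero  · F) i j       k c = F i j k c
(v^ suc a · F) i zero    k c = 0
(v^ suc a · F) i (suc j) k c = (v^ a · F) i j k c
(q^ zero  · F) i j k       c = F i j k c
(q^ suc a · F) i j zero    c = 0
(q^ suc a · F) i j (suc k) c = (q^ a · F) i j k c

∑ : ∀ {A : Set} {P : Pred A 0ℓ} → Enumeration P → (A → Series) → Series
∑ X F i j k c = ListAction.sum (List.map (λ x → F x i j k c) (elements X))

infixr 7 ∑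
syntax ∑ X (λ x → F) = ∑[ x ∈ X ] F

-- From here on n = suc m. Positions and letters 1, …, n are represented by
-- Fin (suc m). The indices 1, …, n-1 are represented by Fin m: for i : Fin m,
-- the pair "i, i+1" is inject₁ i , suc i.

⟪_⟫ : ∀ {m} {P : Pred (Fin m) 0ℓ} → Decidable P → Subset m
⟪ P? ⟫ = tabulate (λ i → does (P? i))

-- The sequences a₁ ≤ ⋯ ≤ aₙ, strict at S, with z_{a₁} ⋯ z_{aₙ} = z^c. Such a
-- sequence only has letters aᵢ ≤ length c, since z_a has exponent 0 in z^c for
-- a > length c.
Contributes : ∀ {m} (S : Subset m) (c : ZMonomial) → Pred (Vec (Fin (length c)) (suc m)) 0ℓ
Contributes {m} S c a =
    (∀ (i : Fin m) → lookup a (inject₁ i) Fin.≤ lookup a (suc i))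
  × (∀ (i : Fin m) → i ∈ S → lookup a (inject₁ i) Fin.< lookup a (suc i))
  × (∀ (k : Fin (length c)) → Vec.count (Fin._≟ k) a ≡ List.lookup c k)

contributes? : ∀ {m} (S : Subset m) c → Decidable (Contributes S c)
contributes? S c a =
        Fin.all? (λ i → lookup a (inject₁ i) Fin.≤? lookup a (suc i))
  ×-dec Fin.all? (λ i → (i ∈? S) →-dec (lookup a (inject₁ i) Fin.<? lookup a (suc i)))
  ×-dec Fin.all? (λ k → Vec.count (Fin._≟ k) a ℕ.≟ List.lookup c k)

contributing : ∀ {m} (S : Subset m) c → Enumeration (Contributes S c)
contributing {m} S c = select (finiteVec (finiteFin (length c)) (suc m)) (contributes? S c)

Q : ∀ {m} → Subset m → Series
Q S zero zero zero c = length (elements (contributing S c))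
Q S _    _    _    c = 0

data Step : Set where
  up horizontal-θ horizontal-ξ down-θξ : Step

rise : Step → ℤ
rise up           = 1ℤ
rise horizontal-θ = 0ℤ
rise horizontal-ξ = 0ℤ
rise down-θξ      = -1ℤ

θ-side ξ-side : Step → Side
θ-side up           = outside
θ-side horizontal-θ = inside
θ-side horizontal-ξ = outside
θ-side down-θξ      = inside
ξ-side up           = outside
ξ-side horizontal-θ = outside
ξ-side horizontal-ξ = inside
ξ-side down-θξ      = inside

Path : ℕ → Set
Path n = Vec Step n

-- The ordinates reached after each step, starting from ordinate h.
heightsFrom : ∀ {n} → ℤ → Path n → Vec ℤ n
heightsFrom h []      = []
heightsFrom h (p ∷ π) = h ℤ.+ rise p ∷ heightsFrom (h ℤ.+ rise p) π

Π>0 : ∀ {m} → Pred (Path (suc m)) 0ℓ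
Π>0 π = head π ≡ up × VecAll.All (1ℤ ℤ.≤_) (heightsFrom 0ℤ π)

T[_] S[_] : ∀ {n} → Path n → Subset n
T[ π ] = Vec.map θ-side π
S[ π ] = Vec.map ξ-side π

χ∉ : Side → ℤ
χ∉ inside  = 0ℤ
χ∉ outside = 1ℤ

-- α₂(T,S), …, αₙ(T,S) from α₁(T,S) and the restrictions of T, S to {2,…,n}.
αFrom : ∀ {n} → ℤ → Subset n → Subset n → Vec ℤ n
αFrom a []      []      = []
αFrom a (t ∷ T) (s ∷ S) = a′ ∷ αFrom a′ T S
  where a′ = a ℤ.+ -1ℤ ℤ.+ χ∉ t ℤ.+ χ∉ s

α⟨_,_⟩ : ∀ {m} → Subset (suc m) → Subset (suc m) → Vec ℤ (suc m)
α⟨ _ ∷ T , _ ∷ S ⟩ = 0ℤ ∷ αFrom 0ℤ T S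

-- ± x^α θ_T ξ_S is recorded as mono α T S.

record Monomial (n : ℕ) : Set where
  constructor mono
  field
    xs : Vec ℕ n
    θs : Subset n
    ξs : Subset n

  α β γ : Fin n → ℕ
  α i = lookup xs i
  β i = if lookup θs i then 1 else 0
  γ i = if lookup ξs i then 1 else 0

  deg-x deg-θ deg-ξ : ℕ
  deg-x = Vec.sum xs
  deg-θ = ∣ θs ∣
  deg-ξ = ∣ ξs ∣

open Monomial public using (deg-x; deg-θ; deg-ξ)

_≼_ : ∀ {n} → Vec ℕ n → Vec ℤ n → Set
_≼_ = Pointwise (λ a b → + a ℤ.≤ b)

InB : ∀ {m} → Pred (Monomial (suc m)) 0ℓ
InB (mono α T S) = (∃ λ π → Π>0 π × T ≡ T[ π ] × S ≡ S[ π ]) × α ≼ α⟨ T , S ⟩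

AscentB : ∀ {m} → Monomial (suc m) → Pred (Fin m) 0ℓ
AscentB b i =
    β (inject₁ i) < β (suc i)
  ⊎ (β (inject₁ i) ≡ 1 × β (suc i) ≡ 1 × α (inject₁ i) ≥ α (suc i) + γ (suc i))
  ⊎ (β (inject₁ i) ≡ 0 × β (suc i) ≡ 0 × α (inject₁ i) < α (suc i) + γ (suc i))
  where open Monomial b

ascentB? : ∀ {m} (b : Monomial (suc m)) → Decidable (AscentB b)
ascentB? b i =
        (β (inject₁ i) ℕ.<? β (suc i))
  ⊎-dec ((β (inject₁ i) ℕ.≟ 1) ×-dec (β (suc i) ℕ.≟ 1) ×-dec (α (inject₁ i) ℕ.≥? α (suc i) + γ (suc i)))
  ⊎-dec ((β (inject₁ i) ℕ.≟ 0) ×-dec (β (suc i) ℕ.≟ 0) ×-dec (α (inject₁ i) ℕ.<? α (suc i) + γ (suc i)))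
  where open Monomial b

Asc : ∀ {m} → Monomial (suc m) → Subset m
Asc b = ⟪ ascentB? b ⟫

finiteStep : Finite Step
finiteStep = record
  { elements = up ∷ horizontal-θ ∷ horizontal-ξ ∷ down-θξ ∷ []
  ; unique   = ((λ ()) All.∷ (λ ()) All.∷ (λ ()) All.∷ All.[])
      AllPairs.∷ ((λ ()) All.∷ (λ ()) All.∷ All.[])
      AllPairs.∷ ((λ ()) All.∷ All.[])
      AllPairs.∷ (All.[] AllPairs.∷ AllPairs.[])
  ; sound    = λ _ → tt
  ; complete = λ { {up} _ → here refl ; {horizontal-θ} _ → there (here refl)
                 ; {horizontal-ξ} _ → there (there (here refl))
                 ; {down-θξ} _ → there (there (there (here refl))) }
  }

up? : ∀ p → Dec (p ≡ up)
up? up           = yes refl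
up? horizontal-θ = no λ ()
up? horizontal-ξ = no λ ()
up? down-θξ      = no λ ()

Π>0? : ∀ {m} → Decidable (Π>0 {m})
Π>0? π = up? (head π) ×-dec VecAll.all? (1ℤ ℤ.≤?_) (heightsFrom 0ℤ π)

step-inj : ∀ p p′ → θ-side p ≡ θ-side p′ → ξ-side p ≡ ξ-side p′ → p ≡ p′
step-inj up           up           _ _ = refl
step-inj horizontal-θ horizontal-θ _ _ = refl
step-inj horizontal-ξ horizontal-ξ _ _ = refl
step-inj down-θξ      down-θξ      _ _ = refl

path-inj : ∀ {n} {π π′ : Path n} → T[ π ] ≡ T[ π′ ] → S[ π ] ≡ S[ π′ ] → π ≡ π′
path-inj {π = []}    {[]}      _ _ = refl
path-inj {π = p ∷ _} {p′ ∷ _} t s = cong₂ _∷_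
  (step-inj p p′ (Vec.∷-injectiveˡ t) (Vec.∷-injectiveˡ s))
  (path-inj (Vec.∷-injectiveʳ t) (Vec.∷-injectiveʳ s))

belowℤ : ∀ b → Enumeration (λ a → + a ℤ.≤ b)
belowℤ (+ b)    = equiv (below (suc b)) (ℤ.+≤+ ∘ ℕ.s≤s⁻¹) (s≤s ∘ ℤ.drop‿+≤+)
belowℤ -[1+ b ] = record
  { elements = [] ; unique = AllPairs.[] ; sound = λ () ; complete = λ () }

box : ∀ {n} (bs : Vec ℤ n) → Enumeration (_≼ bs)
box []       = singleton-[] []
box (b ∷ bs) = equiv (image cons cons-inj (product (belowℤ b) (box bs)))
  (λ { (_ , (p , ps) , refl) → p ∷ ps }) (λ { (p ∷ ps) → _ , (p , ps) , refl })

B : ∀ m → Enumeration (InB {m})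
B m = equiv (image toMonomial toMonomial-inj
              (dependentProduct (λ π → box α⟨ T[ π ] , S[ π ] ⟩)
                (select (finiteVec finiteStep (suc m)) Π>0?)))
  (λ { (_ , (πok , α≼) , refl) → (_ , πok , refl , refl) , α≼ })
  (λ { ((_ , πok , refl , refl) , α≼) → _ , (πok , α≼) , refl })
  where
  toMonomial : Path (suc m) × Vec ℕ (suc m) → Monomial (suc m)
  toMonomial (π , α) = mono α T[ π ] S[ π ]

  toMonomial-inj : ∀ {x y} → toMonomial x ≡ toMonomial y → x ≡ y
  toMonomial-inj eq = cong₂ _,_
    (path-inj (cong Monomial.θs eq) (cong Monomial.ξs eq)) (cong Monomial.xs eq)

-- The word is cut into blocks between positions
-- i and i+1 for each i ∈ cuts.

record SegmentedWord (m : ℕ) : Set where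
  constructor segmented
  field
    word : Vec (Fin (suc m)) (suc m)
    cuts : Subset m

  σ : Fin (suc m) → Fin (suc m)
  σ = lookup word

  IsFirst : Pred (Fin (suc m)) 0ℓ
  IsFirst zero    = ⊤
  IsFirst (suc i) = i ∈ cuts

  -- P holds of the letter immediately to the left of the given position
  -- (in particular there is such a letter).
  Before : Pred (Fin (suc m)) 0ℓ → Pred (Fin (suc m)) 0ℓ
  Before P zero    = ⊥
  Before P (suc i) = P (σ (inject₁ i))

  IsAscent IsDescent : Pred (Fin m) 0ℓ
  IsAscent  i = i ∉ cuts × σ (inject₁ i) Fin.< σ (suc i)
  IsDescent i = i ∉ cuts × σ (inject₁ i) Fin.> σ (suc i)

  IsSminversion : Pred (Fin (suc m) × Fin (suc m)) 0ℓ
  IsSminversion (i , j) = i Fin.< j × σ i Fin.> σ j × (IsFirst j ⊎ Before (Fin._> σ i) j)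

  Thick Thin : Pred (Fin (suc m)) 0ℓ
  Thick i = IsFirst i ⊎ Before (Fin._> σ i) i
  Thin  i = ¬ IsFirst i × Before (Fin._< σ i) i

  Splitting : Pred (Fin m) 0ℓ
  Splitting k = ∃ λ i → ∃ λ j → σ i ≡ inject₁ k × σ j ≡ suc k ×
    ((Thick i × Thin j) ⊎ (Thin i × Thin j × i Fin.< j) ⊎ (Thick i × Thick j × j Fin.< i))

  isFirst? : Decidable IsFirst
  isFirst? zero    = yes tt
  isFirst? (suc i) = i ∈? cuts

  before? : ∀ {P} → Decidable P → Decidable (Before P)
  before? P? zero    = no λ ()
  before? P? (suc i) = P? (σ (inject₁ i))

  isAscent? : Decidable IsAscent
  isAscent? i = ¬? (i ∈? cuts) ×-dec (σ (inject₁ i) Fin.<? σ (suc i))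

  isDescent? : Decidable IsDescent
  isDescent? i = ¬? (i ∈? cuts) ×-dec (σ (suc i) Fin.<? σ (inject₁ i))

  isSminversion? : Decidable IsSminversion
  isSminversion? (i , j) =
    (i Fin.<? j) ×-dec (σ j Fin.<? σ i) ×-dec (isFirst? j ⊎-dec before? (σ i Fin.<?_) j)

  thick? : Decidable Thick
  thick? i = isFirst? i ⊎-dec before? (σ i Fin.<?_) i

  thin? : Decidable Thin
  thin? i = ¬? (isFirst? i) ×-dec before? (Fin._<? σ i) i

  splitting? : Decidable Splitting
  splitting? k = Fin.any? λ i → Fin.any? λ j →
    (σ i Fin.≟ inject₁ k) ×-dec (σ j Fin.≟ suc k) ×-dec
    ((thick? i ×-dec thin? j) ⊎-dec (thin? i ×-dec thin? j ×-dec (i Fin.<? j))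
      ⊎-dec (thick? i ×-dec thick? j ×-dec (j Fin.<? i)))

  asc des sminv : ℕ
  asc   = ∣ ⟪ isAscent? ⟫ ∣
  des   = ∣ ⟪ isDescent? ⟫ ∣
  sminv = length (elements (select finitePair isSminversion?))

  Split : Subset m
  Split = ⟪ splitting? ⟫

open SegmentedWord public using (asc; des; sminv; Split)

IsPermutation : ∀ {n} → Pred (Vec (Fin n) n) 0ℓ
IsPermutation w = Bijective _≡_ _≡_ (lookup w)

isPermutation? : ∀ {n} → Decidable (IsPermutation {n})
isPermutation? w =
        map′ (λ inj {x} {y} → inj x y) (λ inj x y → inj {x} {y})
          (Fin.all? λ x → Fin.all? λ y → (lookup w x Fin.≟ lookup w y) →-dec (x Fin.≟ y))
  ×-dec map′ strictlySurjective⇒surjective surjective⇒strictlySurjective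
          (Fin.all? λ y → Fin.any? λ x → lookup w x Fin.≟ y)

InSW : ∀ {m} → ℕ → ℕ → Pred (SegmentedWord m) 0ℓ
InSW k l τ = IsPermutation (SegmentedWord.word τ) × asc τ ≡ k × des τ ≡ l

finiteSegmentedWord : ∀ m → Finite (SegmentedWord m)
finiteSegmentedWord m = equiv
  (image (uncurry segmented) (λ { {_ , _} {_ , _} refl → refl })
    (product (finiteVec (finiteFin (suc m)) (suc m)) (finiteVec finiteSide m)))
  (λ _ → tt) (λ _ → _ , (tt , tt) , refl)

SW : ∀ m k l → Enumeration (InSW {m} k l)
SW m k l = select (finiteSegmentedWord m) λ τ →
  isPermutation? (SegmentedWord.word τ) ×-dec (asc τ ℕ.≟ k) ×-dec (des τ ℕ.≟ l)

SumBelow : ∀ n → Enumeration (λ ((k , l) : ℕ × ℕ) → k + l < n)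
SumBelow n = equiv (restrict (product (below n) (below n)) (λ (k , l) → k + l ℕ.<? n))
  proj₂
  (λ {(k , l)} k+l<n → (ℕ.≤-<-trans (ℕ.m≤m+n k l) k+l<n , ℕ.≤-<-trans (ℕ.m≤n+m l k) k+l<n) , k+l<n)

{-# OPTIONS --safe #-}

-- The letters 1, …, n of a segmented permutation σ can be inserted one after the other: the letters
-- ≤ v, cut wherever a larger letter or a bar separates them, form h_v fragments, and v is a fragment
-- of its own, or is glued to the right or to the left of an existing fragment, or joins two of them.
-- Let β_v = 1 iff v has a smaller left neighbour in its block, γ_v = 1 iff it has a smaller right
-- neighbour, and let α_v be the number of fragments to the right of the one containing v. The h_v
-- are the heights of the path with these decorations, 0 ≤ α_v < h_v is the bound α_v(T,S), and
-- Σ β_v, Σ γ_v, Σ α_v count the ascents, descents and sminversions. Since α_m and α_{m+1} + γ_{m+1}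
-- are the numbers of starts of fragments of {1,…,m} to the right of m and of m+1, respectively,
-- comparing them tells whether m precedes m+1. Hence Split(σ) is the set of ascents of the monomial,
-- and in the same way the monomial determines the relative position of any two letters, so that
-- σ ↦ ± ∏ x^α θ^β ξ^γ is injective. It is onto by counting: insertion also gives an injection from
-- B_n to the segmented permutations.

module Submission where

open import Defs
import Algebra.Properties.CommutativeMonoid.Sum
open import Data.Bool.Base using (Bool; true; false; not; if_then_else_)
open import Data.Bool.Properties using (not-injective)
open import Data.Fin.Base as Fin using (Fin; zero; suc; toℕ; inject₁)
open import Data.Fin.Induction using (<-weakInduction)
import Data.Fin.Permutation as FinPerm
import Data.Fin.Properties as Fin
open import Data.Fin.Relation.Unary.Top using (view; ‵fromℕ; ‵inject₁)
open import Data.Fin.Subset using (Subset; Side; inside; outside; ∣_∣; _∈_)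
open import Data.Fin.Subset.Properties using (_∈?_; ⊆-antisym)
open import Data.Integer.Base as ℤ using (1ℤ; -1ℤ)
import Data.Integer.Properties as ℤ
open import Data.List.Base as List using (List; []; _∷_; _++_; length; filter; cartesianProduct)
import Data.List.Membership.Propositional as List
import Data.List.Membership.Propositional.Properties as List
import Data.List.Properties as List
open import Data.List.Relation.Binary.Permutation.Propositional using (_↭_; ↭-refl; ↭-trans; ↭-prep)
import Data.List.Relation.Binary.Permutation.Propositional.Properties as Perm
import Data.List.Relation.Unary.All as All
import Data.List.Relation.Unary.All.Properties as All
import Data.List.Relation.Unary.AllPairs as AllPairs
open import Data.List.Relation.Unary.Any using (here; there)
open import Data.List.Relation.Unary.Unique.Propositional using (Unique)
open import Data.Nat.Base using (ℕ; zero; suc; _+_; _≤_; _<_; z≤n; s≤s; s≤s⁻¹)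
open import Data.Nat.ListAction using (sum)
open import Data.Nat.ListAction.Properties using (sum-++; sum-↭)
import Data.Nat.Properties as ℕ
open import Data.Product.Base using (∃; _×_; _,_; proj₁; proj₂)
open import Data.Sum.Base using (_⊎_; inj₁; inj₂)
open import Data.Unit.Base using (⊤; tt)
open import Data.Vec.Base as Vec using (Vec; []; _∷_; lookup)
import Data.Vec.Properties as Vec
open import Data.Vec.Relation.Binary.Pointwise.Inductive using ([]; _∷_)
import Data.Vec.Relation.Unary.All as VecAll
open import Function.Base using (_∘_; id)
open import Function.Bundles using (mk⇔)
open import Function.Consequences.Propositional using (strictlySurjective⇒surjective)
open import Level using (0ℓ)
open import Relation.Binary.Definitions using (Tri; tri<; tri≈; tri>)
open import Relation.Binary.PropositionalEquality
open import Relation.Nullary.Decidable using (Dec; yes; no; does; does-⇔; _×-dec_; _⊎-dec_; ¬?)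
open import Relation.Nullary.Negation using (¬_; contradiction)
open import Relation.Unary using (Pred; Decidable)

-- Sums over finite sets

-- Each element of `xs` is taken out of `ys` once; as it does not recur in `xs`, the rest of `xs` is
-- still contained in what remains of `ys`.
unique-⊆⇒↭ : ∀ {A : Set} {xs ys : List A} → Unique xs → (∀ {x} → x List.∈ xs → x List.∈ ys) →
             ∃ λ zs → ys ↭ xs ++ zs
unique-⊆⇒↭ {xs = []} {ys} _ _ = ys , ↭-refl
unique-⊆⇒↭ {xs = x ∷ xs} (x∉ AllPairs.∷ u) xs⊆ with List.∈-∃++ (xs⊆ (here refl))
... | as , bs , refl =
  let zs , p = unique-⊆⇒↭ u rest⊆ in zs , ↭-trans (Perm.shift x as bs) (↭-prep x p)
  where
  rest⊆ : ∀ {y} → y List.∈ xs → y List.∈ as ++ bs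
  rest⊆ y∈ with Perm.∈-resp-↭ (Perm.shift x as bs) (xs⊆ (there y∈))
  ... | here refl = contradiction refl (All.lookup x∉ y∈)
  ... | there y∈′ = y∈′

unique-map : ∀ {A B : Set} (f : A → B) {xs : List A} →
             (∀ {x y} → x List.∈ xs → y List.∈ xs → f x ≡ f y → x ≡ y) →
             Unique xs → Unique (List.map f xs)
unique-map f {[]} _ _ = AllPairs.[]
unique-map f {x ∷ xs} inj (x∉ AllPairs.∷ u) =
  All.map⁺ (All.tabulate λ y∈ → All.lookup x∉ y∈ ∘ inj (here refl) (there y∈))
  AllPairs.∷ unique-map f (λ x∈ y∈ → inj (there x∈) (there y∈)) u

-- Injectivity is asked only where the predicates hold: the two maps used below are shown injective
-- among permutations and among members of `B`, respectively.
record Injection {A B : Set} {P : Pred A 0ℓ} {Q : Pred B 0ℓ}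
                 (X : Enumeration P) (Y : Enumeration Q) : Set where
  field
    to        : A → B
    maps      : ∀ {x} → P x → Q (to x)
    injective : ∀ {x y} → P x → P y → to x ≡ to y → x ≡ y

module _ {A B : Set} {P : Pred A 0ℓ} {Q : Pred B 0ℓ} {X : Enumeration P} {Y : Enumeration Q} where

  elements-↭ : (f : Injection X Y) → ∃ λ zs → elements Y ↭ List.map (Injection.to f) (elements X) ++ zs
  elements-↭ f = unique-⊆⇒↭
    (unique-map to (λ x∈ y∈ → injective (sound X x∈) (sound X y∈)) (unique X))
    λ y∈ → let x , x∈ , y≡ = List.∈-map⁻ to y∈ in
           subst (List._∈ elements Y) (sym y≡) (complete Y (maps (sound X x∈)))
    where open Injection f

  card-≤ : Injection X Y → length (elements X) ≤ length (elements Y)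
  card-≤ f = let zs , p = elements-↭ f in begin
    length (elements X)                                   ≡⟨ List.length-map to (elements X) ⟨
    length (List.map to (elements X))                     ≤⟨ ℕ.m≤m+n _ (length zs) ⟩
    length (List.map to (elements X)) + length zs         ≡⟨ List.length-++ (List.map to (elements X)) ⟨
    length (List.map to (elements X) ++ zs)               ≡⟨ Perm.↭-length p ⟨
    length (elements Y)                                   ∎
    where open Injection f
          open ℕ.≤-Reasoning

-- An injection between finite sets is onto as soon as there is an injection the other way.
module _ {A B : Set} {P : Pred A 0ℓ} {Q : Pred B 0ℓ} {X : Enumeration P} {Y : Enumeration Q}
         (f : Injection X Y) (g : Injection Y X) where
  open Injection f

  elements-↭-map : elements Y ↭ List.map to (elements X)
  elements-↭-map with elements-↭ f
  ... | [] , p = subst (elements Y ↭_) (List.++-identityʳ _) p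
  ... | z ∷ zs , p = contradiction (card-≤ g) (ℕ.<⇒≱ (begin-strict
    length (elements X)                                   ≡⟨ List.length-map to (elements X) ⟨
    length (List.map to (elements X))                     <⟨ ℕ.m<m+n _ (ℕ.0<1+n {length zs}) ⟩
    length (List.map to (elements X)) + length (z ∷ zs)   ≡⟨ List.length-++ (List.map to (elements X)) ⟨
    length (List.map to (elements X) ++ z ∷ zs)           ≡⟨ Perm.↭-length p ⟨
    length (elements Y)                                   ∎))
    where open ℕ.≤-Reasoning

  ∑-reindex : {F : A → Series} {G : B → Series} → (∀ {x} → P x → F x ≈ G (to x)) → ∑ Y G ≈ ∑ X F
  ∑-reindex {F} {G} F≈G i j k c = begin
    sum (List.map G′ (elements Y))                        ≡⟨ sum-↭ (Perm.map⁺ G′ elements-↭-map) ⟩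
    sum (List.map G′ (List.map to (elements X)))          ≡⟨ cong sum (List.map-∘ (elements X)) ⟨
    sum (List.map (G′ ∘ to) (elements X))                 ≡⟨ cong sum (List.map-cong-local
                                                              (All.tabulate λ x∈ → sym (F≈G (sound X x∈) i j k c))) ⟩
    sum (List.map (λ x → F x i j k c) (elements X))       ∎
    where
    open ≡-Reasoning
    G′ : B → ℕ
    G′ y = G y i j k c

sum-zeros : ∀ {A : Set} (xs : List A) → sum (List.map (λ _ → 0) xs) ≡ 0
sum-zeros []       = refl
sum-zeros (_ ∷ xs) = sum-zeros xs

module _ {A : Set} {P : Pred A 0ℓ} (X : Enumeration P) (F : A → Series) where

  u^-∑ : ∀ a → u^ a · ∑ X F ≈ ∑ X (λ x → u^ a · F x)
  u^-∑ zero    i       j k c = refl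
  u^-∑ (suc a) zero    j k c = sym (sum-zeros (elements X))
  u^-∑ (suc a) (suc i) j k c = u^-∑ a i j k c

  v^-∑ : ∀ a → v^ a · ∑ X F ≈ ∑ X (λ x → v^ a · F x)
  v^-∑ zero    i j       k c = refl
  v^-∑ (suc a) i zero    k c = sym (sum-zeros (elements X))
  v^-∑ (suc a) i (suc j) k c = v^-∑ a i j k c

u^-cong : ∀ a {F G} → F ≈ G → u^ a · F ≈ u^ a · G
u^-cong zero    F≈G i       j k c = F≈G i j k c
u^-cong (suc a) F≈G zero    j k c = refl
u^-cong (suc a) F≈G (suc i) j k c = u^-cong a F≈G i j k c

∑-cong : ∀ {A : Set} {P : Pred A 0ℓ} (X : Enumeration P) {F G : A → Series} →
         (∀ x → F x ≈ G x) → ∑ X F ≈ ∑ X G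
∑-cong X F≈G i j k c = cong sum (List.map-cong (λ x → F≈G x i j k c) (elements X))

-- Sums over enumerations depend only on the underlying lists. Letting a list enumerate its own
-- members makes `∑-dependentProduct` accessible to induction on that list.
enumerate : ∀ {A : Set} {xs : List A} → Unique xs → Enumeration (List._∈ xs)
enumerate {xs = xs} u = record { elements = xs ; unique = u ; sound = λ x∈ → x∈ ; complete = λ x∈ → x∈ }

module _ {A B : Set} {Q : A → Pred B 0ℓ} (Y : ∀ x → Enumeration (Q x)) (F : A → B → Series) where

  private
    ∑-enumerate : ∀ {xs} (u : Unique xs) →
      ∑ (dependentProduct Y (enumerate u)) (λ (x , y) → F x y) ≈ ∑ (enumerate u) (λ x → ∑ (Y x) (F x))
    ∑-enumerate {[]}     _ i j k c = refl
    ∑-enumerate {x ∷ xs} (_ AllPairs.∷ u) i j k c = begin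
      sum (List.map F′ (List.map (x ,_) (elements (Y x)) ++ rest))
        ≡⟨ cong sum (List.map-++ F′ (List.map (x ,_) (elements (Y x))) rest) ⟩
      sum (List.map F′ (List.map (x ,_) (elements (Y x))) ++ List.map F′ rest)
        ≡⟨ sum-++ (List.map F′ (List.map (x ,_) (elements (Y x)))) _ ⟩
      sum (List.map F′ (List.map (x ,_) (elements (Y x)))) + sum (List.map F′ rest)
        ≡⟨ cong₂ _+_ (cong sum (sym (List.map-∘ (elements (Y x))))) (∑-enumerate u i j k c) ⟩
      ∑ (Y x) (F x) i j k c + ∑ (enumerate u) (λ x → ∑ (Y x) (F x)) i j k c ∎
      where
      open ≡-Reasoning
      F′ : A × B → ℕ
      F′ (x , y) = F x y i j k c
      rest : List (A × B)
      rest = elements (dependentProduct Y (enumerate u))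

  ∑-dependentProduct : ∀ {P : Pred A 0ℓ} (X : Enumeration P) →
    ∑ (dependentProduct Y X) (λ (x , y) → F x y) ≈ ∑ X (λ x → ∑ (Y x) (F x))
  ∑-dependentProduct X = ∑-enumerate (unique X)

-- Counting over Fin n

module Fin∑ = Algebra.Properties.CommutativeMonoid.Sum ℕ.+-0-commutativeMonoid

𝟙 : ∀ {P : Set} → Dec P → ℕ
𝟙 P? = if does P? then 1 else 0

# : ∀ {n} {P : Pred (Fin n) 0ℓ} → Decidable P → ℕ
# P? = Fin∑.sum (λ i → 𝟙 (P? i))

𝟙-yes : ∀ {P : Set} (P? : Dec P) → P → 𝟙 P? ≡ 1
𝟙-yes (yes _) _ = refl
𝟙-yes (no ¬p) p = contradiction p ¬p

𝟙-no : ∀ {P : Set} (P? : Dec P) → ¬ P → 𝟙 P? ≡ 0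
𝟙-no (yes p) ¬p = contradiction p ¬p
𝟙-no (no _)  _  = refl

𝟙-yes⁻ : ∀ {P : Set} (P? : Dec P) → 𝟙 P? ≡ 1 → P
𝟙-yes⁻ (yes p) _ = p

𝟙-no⁻ : ∀ {P : Set} (P? : Dec P) → 𝟙 P? ≡ 0 → ¬ P
𝟙-no⁻ (no ¬p) _ = ¬p

𝟙-⇔ : ∀ {P Q : Set} (P? : Dec P) (Q? : Dec Q) → (P → Q) → (Q → P) → 𝟙 P? ≡ 𝟙 Q?
𝟙-⇔ P? Q? to from = cong (if_then 1 else 0) (does-⇔ (mk⇔ to from) P? Q?)

𝟙-mono : ∀ {P Q : Set} (P? : Dec P) (Q? : Dec Q) → (P → Q) → 𝟙 P? ≤ 𝟙 Q?
𝟙-mono (yes p) Q? to rewrite 𝟙-yes Q? (to p) = ℕ.≤-refl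
𝟙-mono (no _)  Q? to = z≤n

sum-mono : ∀ {n} {f g : Fin n → ℕ} → (∀ i → f i ≤ g i) → Fin∑.sum f ≤ Fin∑.sum g
sum-mono {zero}  f≤g = z≤n
sum-mono {suc n} f≤g = ℕ.+-mono-≤ (f≤g zero) (sum-mono (f≤g ∘ suc))

sum-mono-< : ∀ {n} {f g : Fin n → ℕ} → (∀ i → f i ≤ g i) → ∀ i → f i < g i → Fin∑.sum f < Fin∑.sum g
sum-mono-< f≤g zero    f<g = ℕ.+-mono-<-≤ f<g (sum-mono (f≤g ∘ suc))
sum-mono-< f≤g (suc i) f<g = ℕ.+-mono-≤-< (f≤g zero) (sum-mono-< (f≤g ∘ suc) i f<g)

sum-tabulate : ∀ {n} (f : Fin n → ℕ) → Vec.sum (Vec.tabulate f) ≡ Fin∑.sum f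
sum-tabulate {zero}  f = refl
sum-tabulate {suc n} f = cong (f zero +_) (sum-tabulate (f ∘ suc))

module _ {n} {P Q : Pred (Fin n) 0ℓ} (P? : Decidable P) (Q? : Decidable Q) where

  #-cong : (∀ {i} → P i → Q i) → (∀ {i} → Q i → P i) → # P? ≡ # Q?
  #-cong to from = Fin∑.sum-cong-≗ λ i → 𝟙-⇔ (P? i) (Q? i) to from

  #-mono : (∀ {i} → P i → Q i) → # P? ≤ # Q?
  #-mono to = sum-mono λ i → 𝟙-mono (P? i) (Q? i) to

  #-mono-< : (∀ {i} → P i → Q i) → ∀ i → ¬ P i → Q i → # P? < # Q?
  #-mono-< to i ¬p q = sum-mono-< (λ i → 𝟙-mono (P? i) (Q? i) to) i
    (subst₂ _<_ (sym (𝟙-no (P? i) ¬p)) (sym (𝟙-yes (Q? i) q)) ℕ.0<1+n)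

#-empty : ∀ {n} {P : Pred (Fin n) 0ℓ} (P? : Decidable P) → (∀ i → ¬ P i) → # P? ≡ 0
#-empty {n} P? ¬p = trans (Fin∑.sum-cong-≗ λ i → 𝟙-no (P? i) (¬p i)) (Fin∑.sum-replicate-zero n)

#-+ : ∀ {n} {P Q R S : Pred (Fin n) 0ℓ}
      (P? : Decidable P) (Q? : Decidable Q) (R? : Decidable R) (S? : Decidable S) →
      (∀ i → 𝟙 (P? i) + 𝟙 (Q? i) ≡ 𝟙 (R? i) + 𝟙 (S? i)) → # P? + # Q? ≡ # R? + # S?
#-+ P? Q? R? S? eq = begin
  # P? + # Q?                               ≡⟨ Fin∑.∑-distrib-+ (𝟙 ∘ P?) (𝟙 ∘ Q?) ⟨
  Fin∑.sum (λ i → 𝟙 (P? i) + 𝟙 (Q? i))      ≡⟨ Fin∑.sum-cong-≗ eq ⟩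
  Fin∑.sum (λ i → 𝟙 (R? i) + 𝟙 (S? i))      ≡⟨ Fin∑.∑-distrib-+ (𝟙 ∘ R?) (𝟙 ∘ S?) ⟩
  # R? + # S?                               ∎
  where open ≡-Reasoning

#-any : ∀ {n} {P : Pred (Fin n) 0ℓ} (P? : Decidable P) →
        (∀ {i j} → P i → P j → i ≡ j) → # P? ≡ 𝟙 (Fin.any? P?)
#-any {zero}  P? _ = refl
#-any {suc n} {P} P? unique = by-cases (P? zero) refl
  where
  by-cases : (d : Dec (P zero)) → 𝟙 d ≡ 𝟙 (P? zero) → # P? ≡ 𝟙 (Fin.any? P?)
  by-cases (yes p) d≡ = trans
    (cong₂ _+_ (sym d≡) (#-empty (P? ∘ suc) λ i q → contradiction (unique p q) λ ()))
    (sym (𝟙-yes (Fin.any? P?) (zero , p)))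
  by-cases (no ¬p) d≡ = trans
    (cong₂ _+_ (sym d≡) (#-any (P? ∘ suc) λ p q → Fin.suc-injective (unique p q)))
    (𝟙-⇔ (Fin.any? (P? ∘ suc)) (Fin.any? P?)
      (λ (i , p) → suc i , p)
      (λ { (zero , p) → contradiction p ¬p ; (suc i , p) → i , p }))

∣⟪⟫∣ : ∀ {n} {P : Pred (Fin n) 0ℓ} (P? : Decidable P) → ∣ ⟪ P? ⟫ ∣ ≡ # P?
∣⟪⟫∣ {zero}  P? = refl
∣⟪⟫∣ {suc n} P? with does (P? zero)
... | true  = cong suc (∣⟪⟫∣ (P? ∘ suc))
... | false = ∣⟪⟫∣ (P? ∘ suc)

module _ {A : Set} {P : Pred A 0ℓ} (P? : Decidable P) where

  length-filter-tabulate : ∀ {n} (f : Fin n → A) → length (filter P? (List.tabulate f)) ≡ # (P? ∘ f)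
  length-filter-tabulate {zero}  f = refl
  length-filter-tabulate {suc n} f with does (P? (f zero))
  ... | true  = cong suc (length-filter-tabulate (f ∘ suc))
  ... | false = length-filter-tabulate (f ∘ suc)

module _ {A B : Set} {P : Pred (A × B) 0ℓ} (P? : Decidable P) {n} (g : Fin n → B) where

  length-filter-cartesianProduct : ∀ {k} (f : Fin k → A) →
    length (filter P? (cartesianProduct (List.tabulate f) (List.tabulate g)))
      ≡ Fin∑.sum (λ i → # (λ j → P? (f i , g j)))
  length-filter-cartesianProduct {zero}  f = refl
  length-filter-cartesianProduct {suc k} f = begin
    length (filter P? (List.map (f zero ,_) (List.tabulate g) ++ rest))
      ≡⟨ cong length (List.filter-++ P? (List.map (f zero ,_) (List.tabulate g)) rest) ⟩
    length (filter P? (List.map (f zero ,_) (List.tabulate g)) ++ filter P? rest)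
      ≡⟨ List.length-++ (filter P? (List.map (f zero ,_) (List.tabulate g))) ⟩
    length (filter P? (List.map (f zero ,_) (List.tabulate g))) + length (filter P? rest)
      ≡⟨ cong₂ _+_
           (trans (cong (length ∘ filter P?) (List.map-tabulate g (f zero ,_)))
                  (length-filter-tabulate P? (λ j → f zero , g j)))
           (length-filter-cartesianProduct (f ∘ suc)) ⟩
    # (λ j → P? (f zero , g j)) + Fin∑.sum (λ i → # (λ j → P? (f (suc i) , g j))) ∎
    where
    open ≡-Reasoning
    rest : List (A × B)
    rest = cartesianProduct (List.tabulate (f ∘ suc)) (List.tabulate g)

-- The monomial of a segmented word and the fragments of its small letters

module Letters {m} (τ : SegmentedWord m) where
  open SegmentedWord τ hiding (asc; des; sminv; Split)

  position : Fin (suc m) → Fin (suc m)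
  position v with Fin.any? (λ i → σ i Fin.≟ v)
  ... | yes (i , _) = i
  -- Default for a letter that does not occur; in a permutation every letter occurs.
  ... | no _        = zero

  -- The descent that begins at the letter `v` is recorded at its lower end `j`, because that is
  -- where the start of a fragment disappears once `v` joins the small letters.
  DescendsFrom : Fin (suc m) → Pred (Fin (suc m)) 0ℓ
  DescendsFrom v j = ¬ IsFirst j × σ j Fin.< v × Before (_≡ v) j

  descendsFrom? : ∀ v → Decidable (DescendsFrom v)
  descendsFrom? v j = ¬? (isFirst? j) ×-dec (σ j Fin.<? v) ×-dec before? (Fin._≟ v) j

  inversions : Fin (suc m) → ℕ
  inversions i = # (λ j → isSminversion? (i , j))

  monomial : Monomial (suc m)
  monomial = mono (Vec.tabulate (inversions ∘ position))
                  ⟪ thin? ∘ position ⟫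
                  ⟪ (λ v → Fin.any? (descendsFrom? v)) ⟫

  -- Start t j: a fragment of the letters < t starts at position j, with letters counted from 0 and
  -- fragments separated by bars and by letters ≥ t.
  Start : ℕ → Pred (Fin (suc m)) 0ℓ
  Start t j = toℕ (σ j) < t × (IsFirst j ⊎ Before (λ x → t ≤ toℕ x) j)

  start? : ∀ t → Decidable (Start t)
  start? t j = (toℕ (σ j) ℕ.<? t) ×-dec (isFirst? j ⊎-dec before? (λ x → t ℕ.≤? toℕ x) j)

  -- With `p` one past the position of a letter, this is the number of fragments starting to its
  -- right; with `p = 0` it is the number of all fragments.
  starts : ℕ → ℕ → ℕ
  starts t p = # (λ j → (p ℕ.≤? toℕ j) ×-dec start? t j)

  -- Once `v` counts as a small letter, starts change in two places only: `v` itself starts a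
  -- fragment if it is thick, and a smaller letter right after `v` in the same block ceases to start
  -- one. Both changes are added, on opposite sides, to avoid subtraction.
  start-step : ∀ v j → 𝟙 (start? (suc (toℕ v)) j) + 𝟙 (descendsFrom? v j)
                     ≡ 𝟙 (start? (toℕ v) j) + 𝟙 ((σ j Fin.≟ v) ×-dec thick? j)
  start-step v j = by-letter (Fin.<-cmp (σ j) v)
    where
    S⁺? = start? (suc (toℕ v))
    S?  = start? (toℕ v)
    D?  = descendsFrom? v
    T? : ∀ j → Dec (σ j ≡ v × Thick j)
    T? j = (σ j Fin.≟ v) ×-dec thick? j

    Goal : Fin (suc m) → Set
    Goal j = 𝟙 (S⁺? j) + 𝟙 (D? j) ≡ 𝟙 (S? j) + 𝟙 (T? j)

    values : ∀ {j a b c d} → 𝟙 (S⁺? j) ≡ a → 𝟙 (D? j) ≡ b → 𝟙 (S? j) ≡ c → 𝟙 (T? j) ≡ d →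
             a + b ≡ c + d → Goal j
    values p q r s eq = trans (cong₂ _+_ p q) (trans eq (sym (cong₂ _+_ r s)))

    first : ∀ {j} → σ j Fin.< v → IsFirst j → Goal j
    first {j} lt f = values
      (𝟙-yes (S⁺? j) (ℕ.m<n⇒m<1+n lt , inj₁ f)) (𝟙-no (D? j) λ (¬f , _) → ¬f f)
      (𝟙-yes (S? j) (lt , inj₁ f)) (𝟙-no (T? j) λ (eq , _) → Fin.<⇒≢ lt eq) refl

    by-previous : ∀ {i} → σ (suc i) Fin.< v → ¬ IsFirst (suc i) →
                  Tri (σ (inject₁ i) Fin.< v) (σ (inject₁ i) ≡ v) (v Fin.< σ (inject₁ i)) → Goal (suc i)
    by-previous {i} lt ¬f (tri< x<v x≢v _) = values
      (𝟙-no (S⁺? (suc i)) λ { (_ , inj₁ f) → ¬f f ; (_ , inj₂ v<x) → ℕ.<-asym x<v v<x })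
      (𝟙-no (D? (suc i)) λ (_ , _ , eq) → x≢v eq)
      (𝟙-no (S? (suc i)) λ { (_ , inj₁ f) → ¬f f ; (_ , inj₂ v≤x) → ℕ.<⇒≱ x<v v≤x })
      (𝟙-no (T? (suc i)) λ (eq , _) → Fin.<⇒≢ lt eq) refl
    by-previous {i} lt ¬f (tri≈ _ x≡v _) = values
      (𝟙-no (S⁺? (suc i)) λ { (_ , inj₁ f) → ¬f f ; (_ , inj₂ v<x) → Fin.<⇒≢ v<x (sym x≡v) })
      (𝟙-yes (D? (suc i)) (¬f , lt , x≡v))
      (𝟙-yes (S? (suc i)) (lt , inj₂ (ℕ.≤-reflexive (cong toℕ (sym x≡v)))))
      (𝟙-no (T? (suc i)) λ (eq , _) → Fin.<⇒≢ lt eq) refl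
    by-previous {i} lt ¬f (tri> _ x≢v v<x) = values
      (𝟙-yes (S⁺? (suc i)) (ℕ.m<n⇒m<1+n lt , inj₂ v<x))
      (𝟙-no (D? (suc i)) λ (_ , _ , eq) → x≢v eq)
      (𝟙-yes (S? (suc i)) (lt , inj₂ (ℕ.<⇒≤ v<x)))
      (𝟙-no (T? (suc i)) λ (eq , _) → Fin.<⇒≢ lt eq) refl

    smaller : ∀ j → σ j Fin.< v → Dec (IsFirst j) → Goal j
    smaller _       lt (yes f) = first lt f
    smaller zero    lt (no ¬f) = contradiction tt ¬f
    smaller (suc i) lt (no ¬f) = by-previous lt ¬f (Fin.<-cmp (σ (inject₁ i)) v)

    by-letter : Tri (σ j Fin.< v) (σ j ≡ v) (v Fin.< σ j) → Goal j
    by-letter (tri< lt _ _) = smaller j lt (isFirst? j)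
    by-letter (tri≈ ≮ ≡v _) = values
      (𝟙-⇔ (S⁺? j) (T? j)
        (λ (_ , s) → ≡v , subst (λ x → IsFirst j ⊎ Before (Fin._> x) j) (sym ≡v) s)
        (λ (_ , s) → s≤s (ℕ.≤-reflexive (cong toℕ ≡v)) , subst (λ x → IsFirst j ⊎ Before (Fin._> x) j) ≡v s))
      (𝟙-no (D? j) λ (_ , lt , _) → ≮ lt) (𝟙-no (S? j) λ (lt , _) → ≮ lt) refl (ℕ.+-identityʳ _)
    by-letter (tri> ≮ ≢v v<) = values
      (𝟙-no (S⁺? j) λ (lt , _) → ℕ.<⇒≱ v< (s≤s⁻¹ lt)) (𝟙-no (D? j) λ (_ , lt , _) → ≮ lt)
      (𝟙-no (S? j) λ (lt , _) → ≮ lt) (𝟙-no (T? j) λ (eq , _) → ≢v eq) refl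

  starts-step : ∀ v p →
    starts (suc (toℕ v)) p + # (λ j → (p ℕ.≤? toℕ j) ×-dec descendsFrom? v j)
      ≡ starts (toℕ v) p + # (λ j → (p ℕ.≤? toℕ j) ×-dec ((σ j Fin.≟ v) ×-dec thick? j))
  starts-step v p = #-+
    (λ j → (p ℕ.≤? toℕ j) ×-dec start? (suc (toℕ v)) j) (λ j → (p ℕ.≤? toℕ j) ×-dec descendsFrom? v j)
    (λ j → (p ℕ.≤? toℕ j) ×-dec start? (toℕ v) j) (λ j → (p ℕ.≤? toℕ j) ×-dec ((σ j Fin.≟ v) ×-dec thick? j))
    pointwise
    where
    pointwise : ∀ j →
      𝟙 ((p ℕ.≤? toℕ j) ×-dec start? (suc (toℕ v)) j) + 𝟙 ((p ℕ.≤? toℕ j) ×-dec descendsFrom? v j)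
      ≡ 𝟙 ((p ℕ.≤? toℕ j) ×-dec start? (toℕ v) j)
        + 𝟙 ((p ℕ.≤? toℕ j) ×-dec ((σ j Fin.≟ v) ×-dec thick? j))
    pointwise j with does (p ℕ.≤? toℕ j)
    ... | true  = start-step v j
    ... | false = refl

  starts-antitone : ∀ t {p p′} → p ≤ p′ → starts t p′ ≤ starts t p
  starts-antitone t {p} {p′} p≤p′ = #-mono
    (λ j → (p′ ℕ.≤? toℕ j) ×-dec start? t j) (λ j → (p ℕ.≤? toℕ j) ×-dec start? t j)
    λ (p′≤j , s) → ℕ.≤-trans p≤p′ p′≤j , s

  -- Walk to the left from q until the fragment containing q starts.
  fragment-start : ∀ t p q → p ≤ toℕ q → toℕ (σ q) < t →
                   (∀ i → p ≡ suc (toℕ i) → t ≤ toℕ (σ i)) →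
                   ∃ λ j → p ≤ toℕ j × toℕ j ≤ toℕ q × Start t j
  fragment-start t p = <-weakInduction _ base step
    where
    Goal : Pred (Fin (suc m)) 0ℓ
    Goal q = p ≤ toℕ q → toℕ (σ q) < t → (∀ i → p ≡ suc (toℕ i) → t ≤ toℕ (σ i)) →
             ∃ λ j → p ≤ toℕ j × toℕ j ≤ toℕ q × Start t j

    base : Goal zero
    base p≤ lt _ = zero , p≤ , z≤n , lt , inj₁ tt

    step : ∀ i → Goal (inject₁ i) → Goal (suc i)
    step i ih p≤ lt barrier with isFirst? (suc i)
    ... | yes first = suc i , p≤ , ℕ.≤-refl , lt , inj₁ first
    ... | no ¬first with t ℕ.≤? toℕ (σ (inject₁ i))
    ... | yes t≤x = suc i , p≤ , ℕ.≤-refl , lt , inj₂ t≤x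
    ... | no t≰x with ℕ.m≤n⇒m<n∨m≡n p≤
    ... | inj₂ refl = contradiction (barrier (inject₁ i) (cong suc (sym (Fin.toℕ-inject₁ i)))) t≰x
    ... | inj₁ p<1+i =
      let j , p≤j , j≤ , s = ih (subst (p ≤_) (sym (Fin.toℕ-inject₁ i)) (s≤s⁻¹ p<1+i)) (ℕ.≰⇒> t≰x) barrier
      in j , p≤j , ℕ.m≤n⇒m≤1+n (subst (toℕ j ≤_) (Fin.toℕ-inject₁ i) j≤) , s

  -- The fragment containing `q` is counted from `p` but not from beyond `q`. The barrier, a letter
  -- `≥ t` just before `p`, keeps its start from lying to the left of `p`.
  starts-strict : ∀ t p q → p ≤ toℕ q → toℕ (σ q) < t →
                  (∀ i → p ≡ suc (toℕ i) → t ≤ toℕ (σ i)) →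
                  starts t (suc (toℕ q)) < starts t p
  starts-strict t p q p≤q lt barrier =
    let j , p≤j , j≤q , s = fragment-start t p q p≤q lt barrier in
    #-mono-< (λ j → (suc (toℕ q) ℕ.≤? toℕ j) ×-dec start? t j) (λ j → (p ℕ.≤? toℕ j) ×-dec start? t j)
      (λ (q<j , s) → ℕ.≤-trans p≤q (ℕ.<⇒≤ q<j) , s)
      j (λ (q<j , _) → ℕ.<⇒≱ q<j j≤q) (p≤j , s)

-- The statistics of a segmented permutation, read off its monomial

module Permuted {m} (τ : SegmentedWord m) (perm : IsPermutation (SegmentedWord.word τ)) where
  open SegmentedWord τ hiding (asc; des; sminv; Split)
  open Letters τ

  σ-injective : ∀ {i j} → σ i ≡ σ j → i ≡ j
  σ-injective = proj₁ perm

  σ-position : ∀ v → σ (position v) ≡ v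
  σ-position v with Fin.any? (λ i → σ i Fin.≟ v)
  ... | yes (_ , eq) = eq
  ... | no ∄i = let i , eq = proj₂ perm v in contradiction (i , eq refl) ∄i

  position-σ : ∀ i → position (σ i) ≡ i
  position-σ i = σ-injective (σ-position (σ i))

  position-unique : ∀ {i v} → σ i ≡ v → i ≡ position v
  position-unique refl = sym (position-σ _)

  position-injective : ∀ {v w} → position v ≡ position w → v ≡ w
  position-injective {v} {w} eq = trans (sym (σ-position v)) (trans (cong σ eq) (σ-position w))

  Σ-position : ∀ (f : Fin (suc m) → ℕ) → Fin∑.sum (f ∘ position) ≡ Fin∑.sum f
  Σ-position f = sym (Fin∑.sum-permute f (FinPerm.permutation position σ position-σ σ-position))

  thin⇒¬thick : ∀ i → Thin i → ¬ Thick i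
  thin⇒¬thick i       (¬f , _) (inj₁ f) = ¬f f
  thin⇒¬thick (suc i) (_ , lt) (inj₂ gt) = ℕ.<-asym lt gt

  ¬thin⇒thick : ∀ i → ¬ Thin i → Thick i
  ¬thin⇒thick zero _ = inj₁ tt
  ¬thin⇒thick (suc i) ¬thin with isFirst? (suc i) | Fin.<-cmp (σ (inject₁ i)) (σ (suc i))
  ... | yes f | _           = inj₁ f
  ... | no ¬f | tri< lt _ _ = contradiction (¬f , lt) ¬thin
  ... | no ¬f | tri≈ _ eq _ = contradiction (cong toℕ (σ-injective eq))
                                (λ eq → ℕ.1+n≢n (trans (sym eq) (Fin.toℕ-inject₁ i)))
  ... | no ¬f | tri> _ _ gt = inj₂ gt

  thick+thin : ∀ i → 𝟙 (thick? i) + 𝟙 (thin? i) ≡ 1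
  thick+thin i = by-cases (thin? i)
    where
    by-cases : Dec (Thin i) → 𝟙 (thick? i) + 𝟙 (thin? i) ≡ 1
    by-cases (yes t) = cong₂ _+_ (𝟙-no (thick? i) (thin⇒¬thick i t)) (𝟙-yes (thin? i) t)
    by-cases (no ¬t) = cong₂ _+_ (𝟙-yes (thick? i) (¬thin⇒thick i ¬t)) (𝟙-no (thin? i) ¬t)

  thin thick ends-descent : Fin (suc m) → ℕ
  thin v  = 𝟙 (thin? (position v))
  thick v = 𝟙 (thick? (position v))
  ends-descent v = 𝟙 (Fin.any? (descendsFrom? v))

  place : Fin (suc m) → ℕ
  place v = toℕ (position v)

  descendsFrom-place : ∀ v j → DescendsFrom v j → toℕ j ≡ suc (place v)
  descendsFrom-place v zero    (¬first , _)  = contradiction tt ¬first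
  descendsFrom-place v (suc i) (_ , _ , eq) =
    cong suc (trans (sym (Fin.toℕ-inject₁ i)) (cong toℕ (position-unique eq)))

  #-descendsFrom : ∀ v → # (descendsFrom? v) ≡ ends-descent v
  #-descendsFrom v = #-any (descendsFrom? v) λ {i} {j} d d′ →
    Fin.toℕ-injective (trans (descendsFrom-place v i d) (sym (descendsFrom-place v j d′)))

  #-thick : ∀ v → # (λ j → (σ j Fin.≟ v) ×-dec thick? j) ≡ thick v
  #-thick v = trans
    (#-any (λ j → (σ j Fin.≟ v) ×-dec thick? j)
      λ (p , _) (q , _) → trans (position-unique p) (sym (position-unique q)))
    (𝟙-⇔ (Fin.any? λ j → (σ j Fin.≟ v) ×-dec thick? j) (thick? (position v))
      (λ (j , eq , t) → subst Thick (position-unique eq) t)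
      (λ t → position v , σ-position v , t))

  -- From a position not beyond `v`, both changes made by `v` are visible: the start at `v` itself
  -- and the one lost just after it.
  starts-step-≤ : ∀ v p → p ≤ place v →
    starts (suc (toℕ v)) p + ends-descent v ≡ starts (toℕ v) p + thick v
  starts-step-≤ v p p≤ = begin
    starts (suc (toℕ v)) p + ends-descent v
      ≡⟨ cong (starts (suc (toℕ v)) p +_) (#-descendsFrom v) ⟨
    starts (suc (toℕ v)) p + # (descendsFrom? v)
      ≡⟨ cong (starts (suc (toℕ v)) p +_)
           (#-cong (descendsFrom? v) (λ j → (p ℕ.≤? toℕ j) ×-dec descendsFrom? v j)
             (λ {j} d → subst (p ≤_) (sym (descendsFrom-place v j d)) (ℕ.m≤n⇒m≤1+n p≤) , d) proj₂) ⟩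
    starts (suc (toℕ v)) p + # (λ j → (p ℕ.≤? toℕ j) ×-dec descendsFrom? v j)
      ≡⟨ starts-step v p ⟩
    starts (toℕ v) p + # (λ j → (p ℕ.≤? toℕ j) ×-dec ((σ j Fin.≟ v) ×-dec thick? j))
      ≡⟨ cong (starts (toℕ v) p +_)
           (#-cong (λ j → (p ℕ.≤? toℕ j) ×-dec ((σ j Fin.≟ v) ×-dec thick? j))
             (λ j → (σ j Fin.≟ v) ×-dec thick? j)
             proj₂ (λ (eq , t) → subst (p ≤_) (cong toℕ (sym (position-unique eq))) p≤ , eq , t)) ⟩
    starts (toℕ v) p + # (λ j → (σ j Fin.≟ v) ×-dec thick? j)
      ≡⟨ cong (starts (toℕ v) p +_) (#-thick v) ⟩
    starts (toℕ v) p + thick v ∎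
    where open ≡-Reasoning

  no-thick-right : ∀ v p → place v < p →
    # (λ j → (p ℕ.≤? toℕ j) ×-dec ((σ j Fin.≟ v) ×-dec thick? j)) ≡ 0
  no-thick-right v p lt = #-empty (λ j → (p ℕ.≤? toℕ j) ×-dec ((σ j Fin.≟ v) ×-dec thick? j))
    λ j (p≤j , eq , _) → ℕ.<⇒≱ lt (subst (p ≤_) (cong toℕ (position-unique eq)) p≤j)

  -- From just after `v`, the start at `v` is out of sight, but the one lost at `suc (place v)`
  -- still is in range.
  starts-step-≡ : ∀ v → starts (suc (toℕ v)) (suc (place v)) + ends-descent v ≡ starts (toℕ v) (suc (place v))
  starts-step-≡ v = begin
    starts (suc (toℕ v)) p + ends-descent v
      ≡⟨ cong (starts (suc (toℕ v)) p +_) (#-descendsFrom v) ⟨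
    starts (suc (toℕ v)) p + # (descendsFrom? v)
      ≡⟨ cong (starts (suc (toℕ v)) p +_)
           (#-cong (descendsFrom? v) (λ j → (p ℕ.≤? toℕ j) ×-dec descendsFrom? v j)
             (λ {j} d → ℕ.≤-reflexive (sym (descendsFrom-place v j d)) , d) proj₂) ⟩
    starts (suc (toℕ v)) p + # (λ j → (p ℕ.≤? toℕ j) ×-dec descendsFrom? v j)
      ≡⟨ starts-step v p ⟩
    starts (toℕ v) p + # (λ j → (p ℕ.≤? toℕ j) ×-dec ((σ j Fin.≟ v) ×-dec thick? j))
      ≡⟨ cong (starts (toℕ v) p +_) (no-thick-right v p ℕ.≤-refl) ⟩
    starts (toℕ v) p + 0
      ≡⟨ ℕ.+-identityʳ _ ⟩
    starts (toℕ v) p ∎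
    where
    open ≡-Reasoning
    p = suc (place v)

  -- Both changes made by `v` lie to the left of `p`.
  starts-step-> : ∀ v p → suc (place v) < p → starts (suc (toℕ v)) p ≡ starts (toℕ v) p
  starts-step-> v p lt = begin
    starts (suc (toℕ v)) p
      ≡⟨ ℕ.+-identityʳ _ ⟨
    starts (suc (toℕ v)) p + 0
      ≡⟨ cong (starts (suc (toℕ v)) p +_)
           (#-empty (λ j → (p ℕ.≤? toℕ j) ×-dec descendsFrom? v j)
             λ j (p≤j , d) → ℕ.<⇒≱ lt (subst (p ≤_) (descendsFrom-place v j d) p≤j)) ⟨
    starts (suc (toℕ v)) p + # (λ j → (p ℕ.≤? toℕ j) ×-dec descendsFrom? v j)
      ≡⟨ starts-step v p ⟩
    starts (toℕ v) p + # (λ j → (p ℕ.≤? toℕ j) ×-dec ((σ j Fin.≟ v) ×-dec thick? j))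
      ≡⟨ cong (starts (toℕ v) p +_) (no-thick-right v p (ℕ.<-trans ℕ.≤-refl lt)) ⟩
    starts (toℕ v) p + 0
      ≡⟨ ℕ.+-identityʳ _ ⟩
    starts (toℕ v) p ∎
    where open ≡-Reasoning

  -- The smaller letter of a sminversion with `v` heads a fragment of the letters up to `v`.
  -- Conversely, the letter heading such a fragment to the right of `v` is strictly smaller, since
  -- `v` occurs only once.
  inversions≡starts : ∀ v → inversions (position v) ≡ starts (suc (toℕ v)) (suc (place v))
  inversions≡starts v = subst (λ w → inversions (position v) ≡ starts (suc (toℕ w)) (suc (place v)))
    (σ-position v)
    (#-cong (λ j → isSminversion? (position v , j))
      (λ j → (suc (place v) ℕ.≤? toℕ j) ×-dec start? (suc (toℕ (σ (position v)))) j)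
      (λ (i<j , gt , s) → i<j , ℕ.m<n⇒m<1+n gt , s)
      (λ (i<j , le , s) → i<j , ℕ.≤∧≢⇒< (s≤s⁻¹ le)
        (λ eq → Fin.<⇒≢ i<j (sym (σ-injective (Fin.toℕ-injective eq)))) , s))

  inversions+descent : ∀ v → inversions (position v) + ends-descent v ≡ starts (toℕ v) (suc (place v))
  inversions+descent v = trans (cong (_+ ends-descent v) (inversions≡starts v)) (starts-step-≡ v)

  -- The letter `v` is a barrier for the letters below it, so the fragment containing `w` starts
  -- after `v` and not after `w`. Together with `starts-right`, this turns the order of two letters
  -- into a comparison of two counts.
  starts-left : ∀ {w v} → w Fin.< v → place v < place w →
                starts (toℕ v) (suc (place w)) < starts (toℕ v) (suc (place v))
  starts-left {w} {v} w<v q<p = starts-strict (toℕ v) (suc (place v)) (position w) q<p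
    (subst (λ x → toℕ x < toℕ v) (sym (σ-position w)) w<v)
    (λ i eq → ℕ.≤-reflexive (cong toℕ (trans (sym (σ-position v))
      (cong σ (Fin.toℕ-injective {i = position v} {j = i} (ℕ.suc-injective eq))))))

  starts-right : ∀ w v → place w < place v →
                 starts (toℕ v) (suc (place v)) ≤ starts (toℕ v) (suc (place w))
  starts-right w v p<q = starts-antitone (toℕ v) (s≤s (ℕ.<⇒≤ p<q))

  height : ℕ → ℕ
  height t = starts t 0

  height-0 : height 0 ≡ 0
  height-0 = #-empty (λ j → (0 ℕ.≤? toℕ j) ×-dec start? 0 j) λ { _ (_ , () , _) }

  -- From position 0 both changes made by `v` are seen, and `thick v` is `1 − thin v`.
  height-step : ∀ v → height (suc (toℕ v)) + ends-descent v + thin v ≡ suc (height (toℕ v))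
  height-step v = begin
    height (suc (toℕ v)) + ends-descent v + thin v   ≡⟨ cong (_+ thin v) (starts-step-≤ v 0 z≤n) ⟩
    height (toℕ v) + thick v + thin v                ≡⟨ ℕ.+-assoc (height (toℕ v)) _ _ ⟩
    height (toℕ v) + (thick v + thin v)              ≡⟨ cong (height (toℕ v) +_) (thick+thin (position v)) ⟩
    height (toℕ v) + 1                               ≡⟨ ℕ.+-comm (height (toℕ v)) 1 ⟩
    suc (height (toℕ v))                             ∎
    where open ≡-Reasoning

  -- The fragment containing `v` contributes to the height, but it does not start to the right of
  -- `v`.
  inversions<height : ∀ v → inversions (position v) < height (suc (toℕ v))
  inversions<height v = subst (_< height (suc (toℕ v))) (sym (inversions≡starts v))
    (starts-strict (suc (toℕ v)) 0 (position v) z≤n (s≤s (ℕ.≤-reflexive (cong toℕ (σ-position v)))) λ _ ())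

  open Monomial monomial using (α; β; γ)

  α≡ : ∀ v → α v ≡ inversions (position v)
  α≡ v = Vec.lookup∘tabulate (inversions ∘ position) v

  β≡ : ∀ v → β v ≡ thin v
  β≡ v = cong (if_then 1 else 0) (Vec.lookup∘tabulate (λ v → does (thin? (position v))) v)

  γ≡ : ∀ v → γ v ≡ ends-descent v
  γ≡ v = cong (if_then 1 else 0) (Vec.lookup∘tabulate (λ v → does (Fin.any? (descendsFrom? v))) v)

  deg-θ≡asc : deg-θ monomial ≡ asc τ
  deg-θ≡asc = begin
    ∣ ⟪ thin? ∘ position ⟫ ∣   ≡⟨ ∣⟪⟫∣ (thin? ∘ position) ⟩
    # (thin? ∘ position)       ≡⟨ Σ-position (λ i → 𝟙 (thin? i)) ⟩
    -- By computation, `thin?` fails at position zero and is `isAscent? i` at `suc i`.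
    # thin?                    ≡⟨ ∣⟪⟫∣ isAscent? ⟨
    asc τ                      ∎
    where open ≡-Reasoning

  -- Double counting of the pairs of a letter `v` and the lower end `j` of the descent from `v`:
  -- every `v` has at most one `j`, every `j` at most one `v`, and position zero has none.
  deg-ξ≡des : deg-ξ monomial ≡ des τ
  deg-ξ≡des = begin
    ∣ ⟪ (λ v → Fin.any? (descendsFrom? v)) ⟫ ∣
      ≡⟨ ∣⟪⟫∣ (λ v → Fin.any? (descendsFrom? v)) ⟩
    # (λ v → Fin.any? (descendsFrom? v))
      ≡⟨ Fin∑.sum-cong-≗ #-descendsFrom ⟨
    Fin∑.sum (λ v → # (descendsFrom? v))
      ≡⟨ Fin∑.∑-comm (λ v j → 𝟙 (descendsFrom? v j)) ⟩
    Fin∑.sum (λ j → # (λ v → descendsFrom? v j))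
      ≡⟨ Fin∑.sum-cong-≗ (λ j → #-any (λ v → descendsFrom? v j) (λ {v} {w} → same {v} {w} j)) ⟩
    # (λ j → Fin.any? (λ v → descendsFrom? v j))
      ≡⟨ cong₂ _+_ (𝟙-no (Fin.any? (λ v → descendsFrom? v zero)) λ (v , ¬first , _) → ¬first tt)
           (#-cong (λ i → Fin.any? (λ v → descendsFrom? v (suc i))) isDescent?
             (λ { {i} (v , i∉ , lt , refl) → i∉ , lt }) (λ {i} (i∉ , lt) → σ (inject₁ i) , i∉ , lt , refl)) ⟩
    # isDescent?
      ≡⟨ ∣⟪⟫∣ isDescent? ⟨
    des τ ∎
    where
    open ≡-Reasoning
    same : ∀ {v w} j → DescendsFrom v j → DescendsFrom w j → v ≡ w
    same (suc i) (_ , _ , p) (_ , _ , q) = trans (sym p) q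

  deg-x≡sminv : deg-x monomial ≡ sminv τ
  deg-x≡sminv = begin
    Vec.sum (Vec.tabulate (inversions ∘ position))   ≡⟨ sum-tabulate (inversions ∘ position) ⟩
    Fin∑.sum (inversions ∘ position)                 ≡⟨ Σ-position inversions ⟩
    Fin∑.sum inversions                              ≡⟨ length-filter-cartesianProduct isSminversion? id id ⟨
    sminv τ                                          ∎
    where open ≡-Reasoning

  Asc≡Split : Asc monomial ≡ Split τ
  Asc≡Split = Vec.tabulate-cong λ k → does-⇔ (mk⇔ (to k) (from k)) (ascentB? monomial k) (splitting? k)
    where
    module _ (k : Fin m) where
      v w i j : Fin (suc m)
      v = inject₁ k
      w = suc k
      i = position v
      j = position w

      v<w : v Fin.< w
      v<w = s≤s (ℕ.≤-reflexive (Fin.toℕ-inject₁ k))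

      -- The letters up to `v` are those below `w`, so this count and the one for `w` in `αw+γw≡`
      -- concern the same fragments.
      αv≡ : α v ≡ starts (toℕ w) (suc (toℕ i))
      αv≡ = trans (α≡ v) (trans (inversions≡starts v)
        (cong (λ t → starts (suc t) (suc (toℕ i))) (Fin.toℕ-inject₁ k)))

      αw+γw≡ : α w + γ w ≡ starts (toℕ w) (suc (toℕ j))
      αw+γw≡ = trans (cong₂ _+_ (α≡ w) (γ≡ w)) (inversions+descent w)

      i<j⇒ : i Fin.< j → α w + γ w ≤ α v
      i<j⇒ i<j = subst₂ _≤_ (sym αw+γw≡) (sym αv≡) (starts-right v w i<j)

      j<i⇒ : j Fin.< i → α v < α w + γ w
      j<i⇒ j<i = subst₂ _<_ (sym αv≡) (sym αw+γw≡) (starts-left v<w j<i)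

      i≢j : i ≢ j
      i≢j eq = Fin.<⇒≢ v<w (position-injective eq)

      ⇒i<j : α w + γ w ≤ α v → i Fin.< j
      ⇒i<j le with Fin.<-cmp i j
      ... | tri< i<j _ _ = i<j
      ... | tri≈ _ eq _  = contradiction eq i≢j
      ... | tri> _ _ j<i = contradiction le (ℕ.<⇒≱ (j<i⇒ j<i))

      ⇒j<i : α v < α w + γ w → j Fin.< i
      ⇒j<i lt with Fin.<-cmp i j
      ... | tri< i<j _ _ = contradiction (i<j⇒ i<j) (ℕ.<⇒≱ lt)
      ... | tri≈ _ eq _  = contradiction eq i≢j
      ... | tri> _ _ j<i = j<i

      β-thin : ∀ {u} → Thin (position u) → β u ≡ 1
      β-thin {u} t = trans (β≡ u) (𝟙-yes (thin? (position u)) t)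

      β-thick : ∀ {u} → Thick (position u) → β u ≡ 0
      β-thick {u} t = trans (β≡ u) (𝟙-no (thin? (position u)) λ t′ → thin⇒¬thick (position u) t′ t)

      thin-β : ∀ {u} → β u ≡ 1 → Thin (position u)
      thin-β {u} eq = 𝟙-yes⁻ (thin? (position u)) (trans (sym (β≡ u)) eq)

      thick-β : ∀ {u} → β u ≡ 0 → Thick (position u)
      thick-β {u} eq = ¬thin⇒thick (position u) (𝟙-no⁻ (thin? (position u)) (trans (sym (β≡ u)) eq))

      to : AscentB monomial k → Splitting k
      to asc = i , j , σ-position v , σ-position w , cases asc
        where
        cases : AscentB monomial k →
          (Thick i × Thin j) ⊎ (Thin i × Thin j × i Fin.< j) ⊎ (Thick i × Thick j × j Fin.< i)
        cases (inj₂ (inj₁ (βv , βw , le))) = inj₂ (inj₁ (thin-β βv , thin-β βw , ⇒i<j le))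
        cases (inj₂ (inj₂ (βv , βw , lt))) = inj₂ (inj₂ (thick-β βv , thick-β βw , ⇒j<i lt))
        cases (inj₁ lt) with thin? i | thin? j
        ... | no ¬ti | yes tj = inj₁ (¬thin⇒thick i ¬ti , tj)
        ... | yes ti | yes tj = contradiction (subst₂ _<_ (β-thin ti) (β-thin tj) lt) (ℕ.n≮n 1)
        ... | ti     | no ¬tj = contradiction (subst (β v <_) (β-thick (¬thin⇒thick j ¬tj)) lt) λ ()

      from : Splitting k → AscentB monomial k
      from (i′ , j′ , p , q , split) with refl ← position-unique p | refl ← position-unique q = cases split
        where
        cases : (Thick i × Thin j) ⊎ (Thin i × Thin j × i Fin.< j) ⊎ (Thick i × Thick j × j Fin.< i) →
                AscentB monomial k
        cases (inj₁ (ti , tj)) = inj₁ (subst₂ _<_ (sym (β-thick ti)) (sym (β-thin tj)) ℕ.0<1+n)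
        cases (inj₂ (inj₁ (ti , tj , lt))) = inj₂ (inj₁ (β-thin ti , β-thin tj , i<j⇒ lt))
        cases (inj₂ (inj₂ (ti , tj , lt))) = inj₂ (inj₂ (β-thick ti , β-thick tj , j<i⇒ lt))

-- From segmented permutations to monomials

step : Side → Side → Step
step outside outside = up
step inside  outside = horizontal-θ
step outside inside  = horizontal-ξ
step inside  inside  = down-θξ

T[zipWith-step] : ∀ {n} (T S : Subset n) → T[ Vec.zipWith step T S ] ≡ T
T[zipWith-step] []            []            = refl
T[zipWith-step] (outside ∷ T) (outside ∷ S) = cong (outside ∷_) (T[zipWith-step] T S)
T[zipWith-step] (inside  ∷ T) (outside ∷ S) = cong (inside  ∷_) (T[zipWith-step] T S)
T[zipWith-step] (outside ∷ T) (inside  ∷ S) = cong (outside ∷_) (T[zipWith-step] T S)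
T[zipWith-step] (inside  ∷ T) (inside  ∷ S) = cong (inside  ∷_) (T[zipWith-step] T S)

S[zipWith-step] : ∀ {n} (T S : Subset n) → S[ Vec.zipWith step T S ] ≡ S
S[zipWith-step] []            []            = refl
S[zipWith-step] (outside ∷ T) (outside ∷ S) = cong (outside ∷_) (S[zipWith-step] T S)
S[zipWith-step] (inside  ∷ T) (outside ∷ S) = cong (outside ∷_) (S[zipWith-step] T S)
S[zipWith-step] (outside ∷ T) (inside  ∷ S) = cong (inside  ∷_) (S[zipWith-step] T S)
S[zipWith-step] (inside  ∷ T) (inside  ∷ S) = cong (inside  ∷_) (S[zipWith-step] T S)

side : Side → ℕ
side s = if s then 1 else 0

rise-step : ∀ t s {h h′} → h′ + side s + side t ≡ suc h → ℤ.+ h ℤ.+ rise (step t s) ≡ ℤ.+ h′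
rise-step outside outside {h} {h′} eq = cong ℤ.+_
  (trans (ℕ.+-comm h 1) (trans (sym eq) (trans (ℕ.+-identityʳ _) (ℕ.+-identityʳ h′))))
rise-step inside  outside {h} {h′} eq = cong ℤ.+_ (trans (ℕ.+-identityʳ h) (ℕ.suc-injective
  (trans (sym eq) (trans (ℕ.+-comm _ 1) (cong suc (ℕ.+-identityʳ h′))))))
rise-step outside inside  {h} {h′} eq = cong ℤ.+_ (trans (ℕ.+-identityʳ h) (ℕ.suc-injective
  (trans (sym eq) (trans (ℕ.+-identityʳ _) (ℕ.+-comm h′ 1)))))
rise-step inside  inside  {h} {h′} eq with refl ← ℕ.suc-injective
  (trans (sym eq) (trans (ℕ.+-comm _ 1) (cong suc (ℕ.+-comm h′ 1)))) = refl

-- The increment of the bound is the rise of the step, so the bounds run parallel to the path.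
α-step : ∀ t s {a a′} → a′ + side s + side t ≡ suc a →
         ℤ.+ a ℤ.+ -1ℤ ℤ.+ χ∉ t ℤ.+ χ∉ s ≡ ℤ.+ a′
α-step t s {a} eq = begin
  ℤ.+ a ℤ.+ -1ℤ ℤ.+ χ∉ t ℤ.+ χ∉ s       ≡⟨ ℤ.+-assoc (ℤ.+ a ℤ.+ -1ℤ) (χ∉ t) (χ∉ s) ⟩
  ℤ.+ a ℤ.+ -1ℤ ℤ.+ (χ∉ t ℤ.+ χ∉ s)     ≡⟨ ℤ.+-assoc (ℤ.+ a) -1ℤ (χ∉ t ℤ.+ χ∉ s) ⟩
  ℤ.+ a ℤ.+ (-1ℤ ℤ.+ (χ∉ t ℤ.+ χ∉ s))   ≡⟨ cong (λ z → ℤ.+ a ℤ.+ z) (χ-rise t s) ⟩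
  ℤ.+ a ℤ.+ rise (step t s)             ≡⟨ rise-step t s eq ⟩
  ℤ.+ _                                 ∎
  where
  open ≡-Reasoning
  χ-rise : ∀ t s → -1ℤ ℤ.+ (χ∉ t ℤ.+ χ∉ s) ≡ rise (step t s)
  χ-rise outside outside = refl
  χ-rise inside  outside = refl
  χ-rise outside inside  = refl
  χ-rise inside  inside  = refl

-- The recursion `h′ = h + 1 − β − γ` of the heights, with the decorations moved to the left so that
-- it stays in ℕ.
IsHeight : ∀ {n} → Subset n → Subset n → (ℕ → ℕ) → Set
IsHeight T S H = ∀ i → H (suc (toℕ i)) + side (lookup S i) + side (lookup T i) ≡ suc (H (toℕ i))

heights-positive : ∀ {n} (T S : Subset n) H → IsHeight T S H → (∀ (i : Fin n) → 1 ≤ H (suc (toℕ i))) →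
                   VecAll.All (1ℤ ℤ.≤_) (heightsFrom (ℤ.+ H 0) (Vec.zipWith step T S))
heights-positive []      []      H isH pos = VecAll.[]
heights-positive (t ∷ T) (s ∷ S) H isH pos rewrite rise-step t s (isH zero) =
  ℤ.+≤+ (pos zero) VecAll.∷ heights-positive T S (H ∘ suc) (isH ∘ suc) (pos ∘ suc)

≼-αFrom : ∀ {n} (T S : Subset n) (xs : Vec ℕ n) H a → H 0 ≡ suc a → IsHeight T S H →
          (∀ i → lookup xs i < H (suc (toℕ i))) → xs ≼ αFrom (ℤ.+ a) T S
≼-αFrom []      []      []       H a H₀ isH bound = []
-- The height exceeds the bound by one throughout. Since `x < H 1`, the next height is some
-- `suc a′`, and `a′` is the next bound.
≼-αFrom (t ∷ T) (s ∷ S) (x ∷ xs) H a H₀ isH bound with H 1 in H₁ | isH zero | bound zero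
... | suc a′ | eq | s≤s x≤a′ rewrite α-step t s {a} {a′} (ℕ.suc-injective (trans eq (cong suc H₀))) =
  ℤ.+≤+ x≤a′ ∷ ≼-αFrom T S xs (H ∘ suc) a′ H₁ (isH ∘ suc) (bound ∘ suc)

all-zero : ∀ h t s → h + side s + side t ≡ 0 → h ≡ 0 × s ≡ outside × t ≡ outside
all-zero zero outside outside _ = refl , refl , refl

-- With `H 0 = 0` and `H 1` positive there is no room for a decoration on the first step, which is
-- therefore an up-step. All later heights are positive because each strictly bounds an exponent.
inB : ∀ {m} (xs : Vec ℕ (suc m)) T S H → H 0 ≡ 0 → IsHeight T S H →
      (∀ i → lookup xs i < H (suc (toℕ i))) → InB (mono xs T S)
inB (x ∷ xs) (t ∷ T) (s ∷ S) H H₀ isH bound with H 1 in H₁ | isH zero | bound zero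
... | suc h | eq | s≤s x≤h with refl , refl , refl ← all-zero h t s (trans (ℕ.suc-injective eq) H₀) =
  (Vec.zipWith step (outside ∷ T) (outside ∷ S)
   , (refl , subst
       (λ h → VecAll.All (1ℤ ℤ.≤_) (heightsFrom (ℤ.+ h) (Vec.zipWith step (outside ∷ T) (outside ∷ S)))) H₀
       (heights-positive (outside ∷ T) (outside ∷ S) H isH λ i → ℕ.<-≤-trans (s≤s z≤n) (bound i)))
   , sym (T[zipWith-step] (outside ∷ T) (outside ∷ S)) , sym (S[zipWith-step] (outside ∷ T) (outside ∷ S)))
  , ℤ.+≤+ x≤h ∷ ≼-αFrom T S xs (H ∘ suc) 0 H₁ (isH ∘ suc) (bound ∘ suc)

module _ {m} (τ : SegmentedWord m) (perm : IsPermutation (SegmentedWord.word τ)) where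
  open Letters τ
  open Permuted τ perm

  monomial∈B : InB monomial
  monomial∈B = inB _ _ _ height height-0
    (λ v → trans (cong₂ (λ s t → height (suc (toℕ v)) + s + t) (γ≡ v) (β≡ v)) (height-step v))
    (λ v → subst (_< height (suc (toℕ v))) (sym (α≡ v)) (inversions<height v))

-- A segmented permutation is determined by its monomial

expansive : ∀ {n} (f : Fin n → Fin n) → (∀ {i j} → i Fin.< j → f i Fin.< f j) → ∀ i → i Fin.≤ f i
expansive {suc n} f f-mono = <-weakInduction (λ i → i Fin.≤ f i) z≤n
  λ i ih → ℕ.<-≤-trans (s≤s (subst (_≤ toℕ (f (inject₁ i))) (Fin.toℕ-inject₁ i) ih))
    (f-mono (s≤s (ℕ.≤-reflexive (Fin.toℕ-inject₁ i))))

module Compare {m} (τ τ′ : SegmentedWord m)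
  (perm : IsPermutation (SegmentedWord.word τ)) (perm′ : IsPermutation (SegmentedWord.word τ′))
  (same : Letters.monomial τ ≡ Letters.monomial τ′) where

  private
    module L  = Letters τ
    module L′ = Letters τ′
    module P  = Permuted τ perm
    module P′ = Permuted τ′ perm′

  thin≡ : ∀ v → P.thin v ≡ P′.thin v
  thin≡ v = trans (sym (P.β≡ v)) (trans (cong (λ b → Monomial.β b v) same) (P′.β≡ v))

  thick≡ : ∀ v → P.thick v ≡ P′.thick v
  thick≡ v = ℕ.+-cancelʳ-≡ (P.thin v) _ _
    (trans (P.thick+thin (L.position v)) (trans (sym (P′.thick+thin (L′.position v)))
      (cong (P′.thick v +_) (sym (thin≡ v)))))

  ends-descent≡ : ∀ v → P.ends-descent v ≡ P′.ends-descent v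
  ends-descent≡ v = trans (sym (P.γ≡ v)) (trans (cong (λ b → Monomial.γ b v) same) (P′.γ≡ v))

  inversions≡ : ∀ v → L.inversions (L.position v) ≡ L′.inversions (L′.position v)
  inversions≡ v = trans (sym (P.α≡ v)) (trans (cong (λ b → Monomial.α b v) same) (P′.α≡ v))

  inversions+descent≡ : ∀ v → L.starts (toℕ v) (suc (P.place v)) ≡ L′.starts (toℕ v) (suc (P′.place v))
  inversions+descent≡ v = trans (sym (P.inversions+descent v))
    (trans (cong₂ _+_ (inversions≡ v) (ends-descent≡ v)) (P′.inversions+descent v))

  SameStarts : ℕ → Fin (suc m) → Set
  SameStarts t w = L.starts t (suc (P.place w)) ≡ L′.starts t (suc (P′.place w))

  -- If the order were reversed in `τ′`, then `starts-left` there would contradict `starts-right` in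
  -- `τ`, as the counts to the right of `w` and of `v` agree in the two words.
  transfer-< : ∀ {w v} → w Fin.< v → SameStarts (toℕ v) w → P.place w < P.place v → P′.place w < P′.place v
  transfer-< {w} {v} w<v eq p<q with Fin.<-cmp (L′.position w) (L′.position v)
  ... | tri< lt _ _ = lt
  ... | tri≈ _ eq _ = contradiction (P′.position-injective eq) (Fin.<⇒≢ w<v)
  ... | tri> _ _ gt = contradiction (P.starts-right w v p<q)
    (ℕ.<⇒≱ (subst₂ _<_ (sym eq) (sym (inversions+descent≡ v)) (P′.starts-left w<v gt)))

  transfer-> : ∀ {w v} → w Fin.< v → SameStarts (toℕ v) w → P.place v < P.place w → P′.place v < P′.place w
  transfer-> {w} {v} w<v eq q<p with Fin.<-cmp (L′.position w) (L′.position v)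
  ... | tri> _ _ gt = gt
  ... | tri≈ _ eq _ = contradiction (P′.position-injective eq) (Fin.<⇒≢ w<v)
  ... | tri< lt _ _ = contradiction (P′.starts-right w v lt)
    (ℕ.<⇒≱ (subst₂ _<_ eq (inversions+descent≡ v) (P.starts-left w<v q<p)))

  -- Induction on the threshold. At `t = w + 1` the count is the exponent of `w`. By the induction
  -- hypothesis a new letter `v` lies on the same side of `w` in both words; on the left it changes
  -- nothing, on the right the change depends only on `thick v` and `ends-descent v`, which the
  -- monomial determines.
  same-starts : ∀ t w → toℕ w < t → t ≤ suc m → SameStarts t w
  same-starts (suc t) w w≤t t<n with ℕ.m≤n⇒m<n∨m≡n (s≤s⁻¹ w≤t)
  ... | inj₂ refl = trans (sym (P.inversions≡starts w)) (trans (inversions≡ w) (P′.inversions≡starts w))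
  ... | inj₁ w<t = subst (λ t → SameStarts (suc t) w) v≡t (by-place (Fin.<-cmp (L.position w) (L.position v)))
    where
    v : Fin (suc m)
    v = Fin.fromℕ< t<n
    v≡t : toℕ v ≡ t
    v≡t = Fin.toℕ-fromℕ< t<n
    w<v : w Fin.< v
    w<v = subst (toℕ w <_) (sym v≡t) w<t
    ih : SameStarts (toℕ v) w
    ih = subst (λ t → SameStarts t w) (sym v≡t) (same-starts t w w<t (ℕ.<⇒≤ t<n))
    by-place : Tri (P.place w < P.place v) (L.position w ≡ L.position v) (P.place v < P.place w) →
               SameStarts (suc (toℕ v)) w
    by-place (tri≈ _ eq _) = contradiction (P.position-injective eq) (Fin.<⇒≢ w<v)
    by-place (tri> _ _ gt) = trans (P.starts-step-> v _ (s≤s gt))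
      (trans ih (sym (P′.starts-step-> v _ (s≤s (transfer-> w<v ih gt)))))
    by-place (tri< lt _ _) = ℕ.+-cancelʳ-≡ (P.ends-descent v) _ _ (begin
      L.starts (suc (toℕ v)) (suc (P.place w)) + P.ends-descent v     ≡⟨ P.starts-step-≤ v _ lt ⟩
      L.starts (toℕ v) (suc (P.place w)) + P.thick v                  ≡⟨ cong₂ _+_ ih (thick≡ v) ⟩
      L′.starts (toℕ v) (suc (P′.place w)) + P′.thick v               ≡⟨ P′.starts-step-≤ v _ (transfer-< w<v ih lt) ⟨
      L′.starts (suc (toℕ v)) (suc (P′.place w)) + P′.ends-descent v
        ≡⟨ cong (L′.starts (suc (toℕ v)) (suc (P′.place w)) +_) (ends-descent≡ v) ⟨
      L′.starts (suc (toℕ v)) (suc (P′.place w)) + P.ends-descent v   ∎)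
      where open ≡-Reasoning

  same-order : ∀ w v → P.place w < P.place v → P′.place w < P′.place v
  same-order w v p<q with Fin.<-cmp w v
  ... | tri< w<v _ _ = transfer-< w<v (same-starts (toℕ v) w w<v (ℕ.<⇒≤ (Fin.toℕ<n v))) p<q
  ... | tri≈ _ refl _ = contradiction p<q (ℕ.n≮n _)
  ... | tri> _ _ v<w = transfer-> v<w (same-starts (toℕ w) v v<w (ℕ.<⇒≤ (Fin.toℕ<n w))) p<q

  position′∘σ-mono : ∀ {i j} → i Fin.< j →
    L′.position (SegmentedWord.σ τ i) Fin.< L′.position (SegmentedWord.σ τ j)
  position′∘σ-mono {i} {j} i<j = same-order _ _
    (subst₂ Fin._<_ (sym (P.position-σ i)) (sym (P.position-σ j)) i<j)

  -- If `τ′` had no bar at `i`, the letters around it would form an ascent or a descent of `τ′`. The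
  -- monomial records this as `β` of the right letter or `γ` of the left one, so the same ascent or
  -- descent occurs in `τ`, where a bar forbids it.
  cuts-⊆ : SegmentedWord.word τ ≡ SegmentedWord.word τ′ →
           ∀ {i} → i ∈ SegmentedWord.cuts τ → i ∈ SegmentedWord.cuts τ′
  cuts-⊆ refl {i} i∈ with i ∈? SegmentedWord.cuts τ′
  ... | yes i∈′ = i∈′
  ... | no i∉′ with Fin.<-cmp (SegmentedWord.σ τ (inject₁ i)) (SegmentedWord.σ τ (suc i))
  ... | tri≈ _ eq _ = contradiction (cong toℕ (P.σ-injective eq))
                        (λ eq → ℕ.1+n≢n (trans (sym eq) (Fin.toℕ-inject₁ i)))
  ... | tri< lt _ _ = contradiction i∈ (proj₁ thin)
    where
    v = SegmentedWord.σ τ (suc i)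
    thin : SegmentedWord.Thin τ (suc i)
    thin = subst (SegmentedWord.Thin τ) (P.position-σ (suc i))
      (𝟙-yes⁻ (SegmentedWord.thin? τ (L.position v)) (trans (thin≡ v)
        (𝟙-yes (SegmentedWord.thin? τ′ (L′.position v))
          (subst (SegmentedWord.Thin τ′) (sym (P′.position-σ (suc i))) (i∉′ , lt)))))
  ... | tri> _ _ gt with
    𝟙-yes⁻ (Fin.any? (L.descendsFrom? (SegmentedWord.σ τ (inject₁ i))))
      (trans (ends-descent≡ (SegmentedWord.σ τ (inject₁ i)))
      (𝟙-yes (Fin.any? (L′.descendsFrom? (SegmentedWord.σ τ (inject₁ i)))) (suc i , i∉′ , gt , refl)))
  ... | j , d with refl ← Fin.toℕ-injective {i = j} {j = suc i}
    (trans (P.descendsFrom-place _ j d)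
      (cong suc (trans (cong toℕ (P.position-σ (inject₁ i))) (Fin.toℕ-inject₁ i)))) =
    contradiction i∈ (proj₁ d)

monomial-injective : ∀ {m} {τ τ′ : SegmentedWord m} →
  IsPermutation (SegmentedWord.word τ) → IsPermutation (SegmentedWord.word τ′) →
  Letters.monomial τ ≡ Letters.monomial τ′ → τ ≡ τ′
monomial-injective {τ = τ} {τ′} perm perm′ same =
  cong₂ segmented word≡ (⊆-antisym (C.cuts-⊆ word≡) (C′.cuts-⊆ (sym word≡)))
  where
  module C  = Compare τ τ′ perm perm′ same
  module C′ = Compare τ′ τ perm′ perm (sym same)
  module P  = Permuted τ perm
  module P′ = Permuted τ′ perm′
  open SegmentedWord τ using (σ)
  open SegmentedWord τ′ using () renaming (σ to σ′)
  open Letters τ using (position)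
  open Letters τ′ using () renaming (position to position′)

  -- The increasing maps `position′ ∘ σ` and `position ∘ σ′` are inverse to each other, and neither
  -- lowers any index; hence neither raises one.
  fixed : ∀ i → position′ (σ i) ≡ i
  fixed i = Fin.≤-antisym
    (subst (position′ (σ i) Fin.≤_)
      (trans (cong position (P′.σ-position (σ i))) (P.position-σ i))
      (expansive (position ∘ σ′) C′.position′∘σ-mono (position′ (σ i))))
    (expansive (position′ ∘ σ) C.position′∘σ-mono i)

  word≡ : SegmentedWord.word τ ≡ SegmentedWord.word τ′
  word≡ = trans (sym (Vec.tabulate∘lookup _)) (trans
    (Vec.tabulate-cong λ i → trans (sym (P′.σ-position (σ i))) (cong σ′ (fixed i)))
    (Vec.tabulate∘lookup _))

-- From monomials to segmented permutations

module Fold {A : Set} where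

  Op : (ℕ → Set) → Set
  Op B = ∀ {n} → B n → A → B (suc n)

  -- The family is shifted by `suc` at each entry, as in `Vec.foldl`, so that the recursion applies
  -- to the remaining entries.
  Steps : (B : ℕ → Set) (_⊕_ : Op B) (V : ∀ {n} → B n → A → Set) → ∀ {n} → B 0 → Vec A n → Set
  Steps B _⊕_ V e []       = ⊤
  Steps B _⊕_ V e (x ∷ xs) = V e x × Steps (B ∘ suc) _⊕_ V (e ⊕ x) xs

  foldl-invariant : (B : ℕ → Set) (_⊕_ : Op B) (V : ∀ {n} → B n → A → Set) (I : ∀ {n} → B n → Set) →
    (∀ {n} (e : B n) {a} → V e a → I e → I (e ⊕ a)) →
    ∀ {n} e (xs : Vec A n) → Steps B _⊕_ V e xs → I e → I (Vec.foldl B _⊕_ e xs)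
  foldl-invariant B _⊕_ V I pres e []       _        i = i
  foldl-invariant B _⊕_ V I pres e (x ∷ xs) (v , vs) i =
    foldl-invariant (B ∘ suc) _⊕_ V I pres (e ⊕ x) xs vs (pres e v i)

  -- The steps are undone from the last to the first, each returning its entry and the previous
  -- state.
  foldl-injective : (B : ℕ → Set) (_⊕_ : Op B) (V : ∀ {n} → B n → A → Set) →
    (∀ {n} (e e′ : B n) {a a′} → V e a → V e′ a′ → e ⊕ a ≡ e′ ⊕ a′ → e ≡ e′ × a ≡ a′) →
    ∀ {n} e e′ (xs xs′ : Vec A n) → Steps B _⊕_ V e xs → Steps B _⊕_ V e′ xs′ →
    Vec.foldl B _⊕_ e xs ≡ Vec.foldl B _⊕_ e′ xs′ → e ≡ e′ × xs ≡ xs′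
  foldl-injective B _⊕_ V inj e e′ []       []         _        _          eq = eq , refl
  foldl-injective B _⊕_ V inj e e′ (x ∷ xs) (x′ ∷ xs′) (v , vs) (v′ , vs′) eq =
    let eq₁ , xs≡ = foldl-injective (B ∘ suc) _⊕_ V inj (e ⊕ x) (e′ ⊕ x′) xs xs′ vs vs′ eq
        e≡ , x≡   = inj e e′ v v′ eq₁
    in e≡ , cong₂ _∷_ x≡ xs≡

open Fold

-- Each letter is paired with a flag telling whether it is the first of its block.
Word : ℕ → ℕ → Set
Word k n = Vec (Bool × Fin k) n

embed : ∀ {k} → Bool × Fin k → Bool × Fin (suc k)
embed (f , x) = f , inject₁ x

-- Puts the new greatest letter after the j-th block, as a block of its own or glued to the
-- block before it (first = false) or to the block after it (next = false).
insert : ∀ {k n} (j : ℕ) (first next : Bool) → Word k n → Word (suc k) (suc n)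
insert {k} j       first next []                = (first , Fin.fromℕ k) ∷ []
insert     j       first next ((false , x) ∷ w) = (false , inject₁ x) ∷ insert j first next w
insert     (suc j) first next ((true , x) ∷ w)  = (true , inject₁ x) ∷ insert j first next w
insert {k} zero    first next ((true , x) ∷ w)  =
  (first , Fin.fromℕ k) ∷ (next , inject₁ x) ∷ Vec.map embed w

blocks : ∀ {k n} → Word k n → ℕ
blocks []            = 0
blocks ((f , _) ∷ w) = side f + blocks w

blocks-embed : ∀ {k n} (w : Word k n) → blocks (Vec.map embed w) ≡ blocks w
blocks-embed []            = refl
blocks-embed ((f , _) ∷ w) = cong (side f +_) (blocks-embed w)

-- The new letter adds a block if flagged as first, and gluing it to the next block clears one flag.
-- The hypothesis provides that next block when `s` is `inside`.
blocks-insert : ∀ {k n} j first s (w : Word k n) → j + side s ≤ blocks w →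
                blocks (insert j first (not s) w) + side s ≡ side first + blocks w
blocks-insert zero    first outside [] _ = ℕ.+-identityʳ _
blocks-insert j       first s       ((false , x) ∷ w) le = blocks-insert j first s w le
blocks-insert (suc j) first s       ((true , x) ∷ w) (s≤s le) =
  trans (cong suc (blocks-insert j first s w le)) (sym (ℕ.+-suc (side first) (blocks w)))
blocks-insert zero    first outside ((true , x) ∷ w) _ rewrite blocks-embed w = ℕ.+-identityʳ _
blocks-insert zero    first inside  ((true , x) ∷ w) _ rewrite blocks-embed w =
  trans (ℕ.+-assoc (side first) (blocks w) 1) (cong (side first +_) (ℕ.+-comm (blocks w) 1))

embed-injective : ∀ {k n} (w w′ : Word k n) → Vec.map embed w ≡ Vec.map embed w′ → w ≡ w′
embed-injective []            []              _  = refl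
embed-injective ((f , x) ∷ w) ((f′ , x′) ∷ w′) eq =
  cong₂ _∷_ (cong₂ _,_ (cong proj₁ (Vec.∷-injectiveˡ eq))
                       (Fin.inject₁-injective (cong proj₂ (Vec.∷-injectiveˡ eq))))
            (embed-injective w w′ (Vec.∷-injectiveʳ eq))

-- The new letter is recognised as the only `fromℕ` among letters `inject₁ x`. The number of flags
-- before it is `j`, its own flag is `f`, and the flag after it reveals `s`, since in `w` that flag
-- was `true`; at the end of the word the hypothesis forces `s` to be `outside`.
insert-injective : ∀ {k n} {j j′ f f′} s s′ (w w′ : Word k n) →
  j + side s ≤ blocks w → j′ + side s′ ≤ blocks w′ →
  insert j f (not s) w ≡ insert j′ f′ (not s′) w′ → (j ≡ j′ × f ≡ f′ × s ≡ s′) × w ≡ w′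
insert-injective {j = zero} {zero} outside outside [] [] _ _ eq =
  (refl , cong proj₁ (Vec.∷-injectiveˡ eq) , refl) , refl
insert-injective {j = zero} {zero} s s′ ((true , x) ∷ w) ((true , x′) ∷ w′) _ _ eq =
  (refl , cong proj₁ (Vec.∷-injectiveˡ eq)
        , not-injective (cong proj₁ (Vec.∷-injectiveˡ (Vec.∷-injectiveʳ eq))))
  , cong₂ _∷_ (cong (true ,_) (Fin.inject₁-injective (cong proj₂ (Vec.∷-injectiveˡ (Vec.∷-injectiveʳ eq)))))
              (embed-injective w w′ (Vec.∷-injectiveʳ (Vec.∷-injectiveʳ eq)))
insert-injective {j = zero} {suc j′} s s′ ((true , x) ∷ w) ((true , x′) ∷ w′) _ _ eq =
  contradiction (cong proj₂ (Vec.∷-injectiveˡ eq)) Fin.fromℕ≢inject₁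
insert-injective {j = suc j} {zero} s s′ ((true , x) ∷ w) ((true , x′) ∷ w′) _ _ eq =
  contradiction (sym (cong proj₂ (Vec.∷-injectiveˡ eq))) Fin.fromℕ≢inject₁
insert-injective {j = suc j} {suc j′} s s′ ((true , x) ∷ w) ((true , x′) ∷ w′) (s≤s le) (s≤s le′) eq
  with (refl , f≡ , s≡) , refl ← insert-injective s s′ w w′ le le′ (Vec.∷-injectiveʳ eq)
     | refl ← Fin.inject₁-injective (cong proj₂ (Vec.∷-injectiveˡ eq)) =
  (refl , f≡ , s≡) , refl
insert-injective s s′ ((false , x) ∷ w) ((false , x′) ∷ w′) le le′ eq
  with js≡ , refl ← insert-injective s s′ w w′ le le′ (Vec.∷-injectiveʳ eq)
     | refl ← Fin.inject₁-injective (cong proj₂ (Vec.∷-injectiveˡ eq)) =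
  js≡ , refl
insert-injective {j = zero} s s′ ((true , x) ∷ w) ((false , x′) ∷ w′) _ _ eq =
  contradiction (cong proj₂ (Vec.∷-injectiveˡ eq)) Fin.fromℕ≢inject₁
insert-injective {j = suc j} s s′ ((true , x) ∷ w) ((false , x′) ∷ w′) _ _ eq =
  contradiction (cong proj₁ (Vec.∷-injectiveˡ eq)) λ ()
insert-injective {j′ = zero} s s′ ((false , x) ∷ w) ((true , x′) ∷ w′) _ _ eq =
  contradiction (sym (cong proj₂ (Vec.∷-injectiveˡ eq))) Fin.fromℕ≢inject₁
insert-injective {j′ = suc j′} s s′ ((false , x) ∷ w) ((true , x′) ∷ w′) _ _ eq =
  contradiction (cong proj₁ (Vec.∷-injectiveˡ eq)) λ ()

Contains : ∀ {k n} → Word k n → Fin k → Set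
Contains w y = ∃ λ i → proj₂ (lookup w i) ≡ y

later : ∀ {k n} {p} {w : Word k n} {y} → Contains w y → Contains (p ∷ w) y
later (i , eq) = suc i , eq

embed-contains : ∀ {k n} (w : Word k n) {y} → Contains w y → Contains (Vec.map embed w) (inject₁ y)
embed-contains (_ ∷ w) (zero  , refl) = zero , refl
embed-contains (_ ∷ w) (suc i , eq)   = later (embed-contains w (i , eq))

insert-contains-new : ∀ {k n} j f d (w : Word k n) → Contains (insert j f d w) (Fin.fromℕ k)
insert-contains-new j       f d []                = zero , refl
insert-contains-new j       f d ((false , _) ∷ w) = later (insert-contains-new j f d w)
insert-contains-new (suc j) f d ((true , _) ∷ w)  = later (insert-contains-new j f d w)
insert-contains-new zero    f d ((true , _) ∷ w)  = zero , refl

insert-contains-old : ∀ {k n} j f d (w : Word k n) {y} → Contains w y → Contains (insert j f d w) (inject₁ y)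
insert-contains-old j       f d ((false , _) ∷ w) (zero  , refl) = zero , refl
insert-contains-old j       f d ((false , _) ∷ w) (suc i , eq)   = later (insert-contains-old j f d w (i , eq))
insert-contains-old (suc j) f d ((true , _) ∷ w)  (zero  , refl) = zero , refl
insert-contains-old (suc j) f d ((true , _) ∷ w)  (suc i , eq)   = later (insert-contains-old j f d w (i , eq))
insert-contains-old zero    f d ((true , _) ∷ w)  (zero  , refl) = suc zero , refl
insert-contains-old zero    f d ((true , _) ∷ w)  (suc i , eq)   = later (later (embed-contains w (i , eq)))

insert-covers : ∀ {k n} j f d (w : Word k n) → (∀ y → Contains w y) → ∀ y → Contains (insert j f d w) y
insert-covers j f d w cov y with view y
... | ‵fromℕ     = insert-contains-new j f d w
... | ‵inject₁ x = insert-contains-old j f d w (cov x)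

-- A section of `f` is injective. If it missed some `x`, punching `x` out would inject `Fin (suc n)`
-- into `Fin n`; so it is onto and inverts `f` on both sides.
surjective⇒injective : ∀ {n} (f : Fin n → Fin n) → (∀ y → ∃ λ x → f x ≡ y) → ∀ {x y} → f x ≡ f y → x ≡ y
surjective⇒injective {suc n} f surj fx≡fy = trans (sym (section-f _)) (trans (cong section fx≡fy) (section-f _))
  where
  section : Fin (suc n) → Fin (suc n)
  section y = proj₁ (surj y)
  f-section : ∀ y → f (section y) ≡ y
  f-section y = proj₂ (surj y)
  section-f : ∀ x → section (f x) ≡ x
  section-f x with Fin.any? (λ y → section y Fin.≟ x)
  ... | yes (y , refl) = cong section (f-section y)
  ... | no ∄y = contradiction
    (Fin.injective⇒≤ {f = λ y → Fin.punchOut {i = x} {j = section y} λ eq → ∄y (y , sym eq)}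
      λ {y} {z} eq → trans (sym (f-section y)) (trans (cong f
        (Fin.punchOut-injective {i = x} (λ eq → ∄y (y , sym eq)) (λ eq → ∄y (z , sym eq)) eq)) (f-section z)))
    ℕ.1+n≰n

-- `toWord` forgets the flag of the first letter, since a block always starts there; this invariant
-- recovers it.
Headed : ∀ {k n} → Word k n → Set
Headed []            = ⊤
Headed ((f , _) ∷ _) = f ≡ true

Entry : Set
Entry = ℕ × Side × Side

State : ℕ → Set
State n = Word n n

-- Here `a` is the number of blocks to the left of the block receiving the new letter, whereas
-- `monomial` counts to the right. The two maps are not inverse to each other; the counting argument
-- needs only that both are injective.
_⊕_ : Op {Entry} State
w ⊕ (a , t , s) = insert (a + side t) (not t) (not s) w

-- Room for `a` blocks on the left, and for one block on each side where the new letter is glued.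
Fits : ∀ {n} → State n → Entry → Set
Fits w (a , t , s) = a + side t + side s ≤ blocks w

⊕-headed : ∀ {n} (w : State n) {e} → Fits w e → Headed w → Headed (w ⊕ e)
⊕-headed []               {zero  , outside , _} _ _ = refl
⊕-headed ((true , _) ∷ w) {zero  , outside , _} _ _ = refl
⊕-headed ((true , _) ∷ w) {zero  , inside  , _} _ _ = refl
⊕-headed ((true , _) ∷ w) {suc a , _       , _} _ _ = refl

⊕-covers : ∀ {n} (w : State n) {e} → Fits w e → (∀ y → Contains w y) → ∀ y → Contains (w ⊕ e) y
⊕-covers w {a , t , s} _ = insert-covers (a + side t) (not t) (not s) w

⊕-injective : ∀ {n} (w w′ : State n) {e e′} → Fits w e → Fits w′ e′ → w ⊕ e ≡ w′ ⊕ e′ → w ≡ w′ × e ≡ e′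
⊕-injective w w′ {a , t , s} {a′ , t′ , s′} fits fits′ eq
  with (a≡ , nt≡ , refl) , w≡ ← insert-injective s s′ w w′ fits fits′ eq
  with refl ← not-injective {t} {t′} nt≡
  with refl ← ℕ.+-cancelʳ-≡ (side t) a a′ a≡ = w≡ , refl

blocks-⊕ : ∀ {n} (w : State n) {a t s} → Fits w (a , t , s) →
           blocks (w ⊕ (a , t , s)) + side s + side t ≡ suc (blocks w)
blocks-⊕ w {a} {t} {s} fits = begin
  blocks (w ⊕ (a , t , s)) + side s + side t   ≡⟨ cong (_+ side t) (blocks-insert (a + side t) (not t) s w fits) ⟩
  side (not t) + blocks w + side t             ≡⟨ not-side t ⟩
  suc (blocks w)                               ∎
  where
  open ≡-Reasoning
  not-side : ∀ t → side (not t) + blocks w + side t ≡ suc (blocks w)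
  not-side outside = ℕ.+-identityʳ _
  not-side inside  = ℕ.+-comm (blocks w) 1

-- The next bound is negative only if two decorations meet the bound 0, and then no exponent `x`
-- lies below it.
≤-α-step : ∀ t s {a x} → ℤ.+ x ℤ.≤ ℤ.+ a ℤ.+ -1ℤ ℤ.+ χ∉ t ℤ.+ χ∉ s →
           ∃ λ a′ → a′ + side s + side t ≡ suc a × x ≤ a′
≤-α-step t s {a} {x} x≤ = let a′ , eq = next t s a x x≤ in
  a′ , eq , ℤ.drop‿+≤+ (subst (ℤ.+ x ℤ.≤_) (α-step t s eq) x≤)
  where
  next : ∀ t s a x → ℤ.+ x ℤ.≤ ℤ.+ a ℤ.+ -1ℤ ℤ.+ χ∉ t ℤ.+ χ∉ s → ∃ λ a′ → a′ + side s + side t ≡ suc a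
  next outside outside a       x _  = suc a , trans (ℕ.+-identityʳ _) (ℕ.+-identityʳ _)
  next inside  outside a       x _  = a , trans (ℕ.+-comm _ 1) (cong suc (ℕ.+-identityʳ a))
  next outside inside  a       x _  = a , trans (ℕ.+-identityʳ _) (ℕ.+-comm a 1)
  next inside  inside  (suc a) x _  = a , trans (ℕ.+-comm _ 1) (cong suc (ℕ.+-comm a 1))
  next inside  inside  zero    x ()

fits-bound : ∀ {a′ a x} t s → a′ + side s + side t ≡ suc a → x ≤ a′ → x + side t + side s ≤ suc a
fits-bound {a′} {a} {x} t s eq x≤a′ = begin
  x + side t + side s    ≡⟨ ℕ.+-assoc x _ _ ⟩
  x + (side t + side s)  ≤⟨ ℕ.+-mono-≤ x≤a′ (ℕ.≤-reflexive (ℕ.+-comm (side t) (side s))) ⟩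
  a′ + (side s + side t) ≡⟨ ℕ.+-assoc a′ _ _ ⟨
  a′ + side s + side t   ≡⟨ eq ⟩
  suc a                  ∎
  where open ℕ.≤-Reasoning

entries : ∀ {n} → Monomial n → Vec Entry n
entries (mono xs T S) = Vec.zip xs (Vec.zip T S)

entries-injective : ∀ {n} (b b′ : Monomial n) → entries b ≡ entries b′ → b ≡ b′
entries-injective (mono [] [] []) (mono [] [] []) _ = refl
entries-injective (mono (x ∷ xs) (t ∷ T) (s ∷ S)) (mono (x′ ∷ xs′) (t′ ∷ T′) (s′ ∷ S′)) eq
  with refl ← Vec.∷-injectiveˡ eq
     | refl ← entries-injective (mono xs T S) (mono xs′ T′ S′) (Vec.∷-injectiveʳ eq) = refl

-- The bounds on α say exactly that every letter fits, the number of blocks being the height.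
αFrom-steps : (B : ℕ → Set) (_⊕_ : Op {Entry} B) (blocks : ∀ {n} → B n → ℕ) →
  (∀ {n} (w : B n) {a t s} → a + side t + side s ≤ blocks w →
    blocks (w ⊕ (a , t , s)) + side s + side t ≡ suc (blocks w)) →
  ∀ {n} (w : B 0) a xs (T S : Subset n) → blocks w ≡ suc a → xs ≼ αFrom (ℤ.+ a) T S →
  Steps B _⊕_ (λ w (a , t , s) → a + side t + side s ≤ blocks w) w (entries (mono xs T S))
αFrom-steps B _⊕_ blocks blocks-⊕ w a [] [] [] _ _ = tt
αFrom-steps B _⊕_ blocks blocks-⊕ w a (x ∷ xs) (t ∷ T) (s ∷ S) bl (x≤ ∷ xs≼) with ≤-α-step t s x≤
... | a′ , eq , x≤a′ = fits ,
  αFrom-steps (B ∘ suc) _⊕_ blocks blocks-⊕ (w ⊕ (x , t , s)) a′ xs T S bl′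
    (subst (λ z → xs ≼ αFrom z T S) (α-step t s eq) xs≼)
  where
  fits : x + side t + side s ≤ blocks w
  fits = subst (x + side t + side s ≤_) (sym bl) (fits-bound t s eq x≤a′)
  bl′ : blocks (w ⊕ (x , t , s)) ≡ suc a′
  bl′ = ℕ.+-cancelʳ-≡ (side s) _ _ (ℕ.+-cancelʳ-≡ (side t) _ _
    (trans (blocks-⊕ w fits) (trans (cong suc bl) (cong suc (sym eq)))))

-- The first step is an up-step and the first bound is 0, so the first entry is
-- `zero , outside , outside`. It creates one block, one more than the bound, as `αFrom-steps`
-- requires.
inB⇒steps : ∀ {m} {b : Monomial (suc m)} → InB b → Steps State _⊕_ Fits [] (entries b)
inB⇒steps {b = mono (zero ∷ xs) (outside ∷ T) (outside ∷ S)} (_ , _ ∷ xs≼) =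
  z≤n , αFrom-steps (State ∘ suc) _⊕_ blocks blocks-⊕ _ 0 xs T S refl xs≼
inB⇒steps {b = mono (zero ∷ xs) (inside ∷ T) S}           ((up ∷ π , _ , () , _) , _)
inB⇒steps {b = mono (zero ∷ xs) (outside ∷ T) (inside ∷ S)} ((up ∷ π , _ , _ , ()) , _)
inB⇒steps {b = mono (suc x ∷ xs) (_ ∷ T) (_ ∷ S)} (_ , ℤ.+≤+ () ∷ _)

toWord : ∀ {m} → State (suc m) → SegmentedWord m
toWord w = segmented (Vec.map proj₂ w) (Vec.tail (Vec.map proj₁ w))

toWord-injective : ∀ {m} (w w′ : State (suc m)) → Headed w → Headed w′ → toWord w ≡ toWord w′ → w ≡ w′
toWord-injective ((true , x) ∷ w) ((true , x′) ∷ w′) refl refl eq =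
  cong₂ _∷_ (cong (true ,_) (Vec.∷-injectiveˡ (cong SegmentedWord.word eq)))
    (unzip-injective w w′ (cong SegmentedWord.cuts eq) (Vec.∷-injectiveʳ (cong SegmentedWord.word eq)))
  where
  unzip-injective : ∀ {k n} (w w′ : Word k n) → Vec.map proj₁ w ≡ Vec.map proj₁ w′ →
                    Vec.map proj₂ w ≡ Vec.map proj₂ w′ → w ≡ w′
  unzip-injective []      []        _ _ = refl
  unzip-injective (_ ∷ w) (_ ∷ w′) p q =
    cong₂ _∷_ (cong₂ _,_ (Vec.∷-injectiveˡ p) (Vec.∷-injectiveˡ q))
              (unzip-injective w w′ (Vec.∷-injectiveʳ p) (Vec.∷-injectiveʳ q))

build : ∀ {m} → Monomial (suc m) → State (suc m)
build b = Vec.foldl State _⊕_ [] (entries b)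

covers⇒permutation : ∀ {n} (w : State n) → (∀ y → Contains w y) → IsPermutation (Vec.map proj₂ w)
covers⇒permutation w cov =
  surjective⇒injective (lookup (Vec.map proj₂ w)) surj , strictlySurjective⇒surjective surj
  where
  surj : ∀ y → ∃ λ x → lookup (Vec.map proj₂ w) x ≡ y
  surj y = let i , eq = cov y in i , trans (Vec.lookup-map i proj₂ w) eq

toWord-build-permutation : ∀ {m} {b : Monomial (suc m)} → InB b →
                           IsPermutation (SegmentedWord.word (toWord (build b)))
toWord-build-permutation {b = b} b∈ = covers⇒permutation (build b)
  (foldl-invariant State _⊕_ Fits (λ w → ∀ y → Contains w y) ⊕-covers [] (entries b) (inB⇒steps b∈) λ ())

toWord-build-injective : ∀ {m} {b b′ : Monomial (suc m)} → InB b → InB b′ →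
                         toWord (build b) ≡ toWord (build b′) → b ≡ b′
toWord-build-injective {b = b} {b′} b∈ b′∈ eq = entries-injective b b′ (proj₂
  (foldl-injective State _⊕_ Fits ⊕-injective [] [] (entries b) (entries b′) (inB⇒steps b∈) (inB⇒steps b′∈)
    (toWord-injective (build b) (build b′) (headed b∈) (headed b′∈) eq)))
  where
  headed : ∀ {b} → InB b → Headed (build b)
  headed {b} b∈ = foldl-invariant State _⊕_ Fits Headed ⊕-headed [] (entries b) (inB⇒steps b∈) tt

-- Assembling the identity

asc+des≤ : ∀ {m} (τ : SegmentedWord m) → asc τ + des τ ≤ m
asc+des≤ {m} τ = begin
  asc τ + des τ                                      ≡⟨ cong₂ _+_ (∣⟪⟫∣ isAscent?) (∣⟪⟫∣ isDescent?) ⟩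
  # isAscent? + # isDescent?
    ≡⟨ Fin∑.∑-distrib-+ (λ i → 𝟙 (isAscent? i)) (λ i → 𝟙 (isDescent? i)) ⟨
  Fin∑.sum (λ i → 𝟙 (isAscent? i) + 𝟙 (isDescent? i)) ≤⟨ sum-mono at-most-one ⟩
  Fin∑.sum {m} (λ _ → 1)                             ≡⟨ sum-ones m ⟩
  m                                                  ∎
  where
  open SegmentedWord τ using (isAscent?; isDescent?)
  open ℕ.≤-Reasoning
  at-most-one : ∀ i → 𝟙 (isAscent? i) + 𝟙 (isDescent? i) ≤ 1
  at-most-one i = disjoint (isAscent? i) (isDescent? i) λ (_ , lt) (_ , gt) → ℕ.<-asym lt gt
    where
    disjoint : ∀ {P Q : Set} (P? : Dec P) (Q? : Dec Q) → (P → ¬ Q) → 𝟙 P? + 𝟙 Q? ≤ 1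
    disjoint (yes p) (yes q) ¬pq = contradiction q (¬pq p)
    disjoint (yes _) (no _)  _   = ℕ.≤-refl
    disjoint (no _)  (yes _) _   = ℕ.≤-refl
    disjoint (no _)  (no _)  _   = z≤n
  sum-ones : ∀ n → Fin∑.sum {n} (λ _ → 1) ≡ n
  sum-ones zero    = refl
  sum-ones (suc n) = cong suc (sum-ones n)

module _ (m : ℕ) where

  -- The double sum is treated as one sum over pairs, in which `(k , l)` is determined by the
  -- permutation.
  allSW = dependentProduct (λ (k , l) → SW m k l) (SumBelow (suc m))

  SW→B : Injection allSW (B m)
  SW→B = record
    { to        = λ (_ , τ) → Letters.monomial τ
    ; maps      = λ {(_ , τ)} (_ , perm , _) → monomial∈B τ perm
    ; injective = λ { {_ , τ} {_ , τ′} (_ , perm , refl , refl) (_ , perm′ , refl , refl) eq →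
        cong (λ τ → (asc τ , des τ) , τ) (monomial-injective perm perm′ eq) }
    }

  B→SW : Injection (B m) allSW
  B→SW = record
    { to        = λ b → (asc (toWord (build b)) , des (toWord (build b))) , toWord (build b)
    -- Each gap between neighbouring letters is at most one of an ascent and a descent, so the pair
    -- of counts lies in the index range `k + l < suc m`.
    ; maps      = λ {b} b∈ → s≤s (asc+des≤ (toWord (build b))) , toWord-build-permutation b∈ , refl , refl
    ; injective = λ b∈ b′∈ eq → toWord-build-injective b∈ b′∈ (cong proj₂ eq)
    }

weightB : ∀ {m} → Monomial (suc m) → Series
weightB b = u^ deg-θ b · v^ deg-ξ b · q^ deg-x b · Q (Asc b)

weightSW : ∀ {m} → ℕ × ℕ → SegmentedWord m → Series
weightSW (k , l) τ = u^ k · v^ l · q^ sminv τ · Q (Split τ)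

factor : ∀ m ((k , l) : ℕ × ℕ) → u^ k · v^ l · ∑[ σ ∈ SW m k l ] q^ sminv σ · Q (Split σ)
                                   ≈ ∑ (SW m k l) (weightSW (k , l))
factor m (k , l) i j q c = trans
  (u^-cong k (v^-∑ (SW m k l) (λ σ → q^ sminv σ · Q (Split σ)) l) i j q c)
  (u^-∑ (SW m k l) (λ σ → v^ l · q^ sminv σ · Q (Split σ)) k i j q c)

weight-preserving : ∀ {m} (τ : SegmentedWord m) → IsPermutation (SegmentedWord.word τ) →
  weightSW (asc τ , des τ) τ ≈ weightB (Letters.monomial τ)
weight-preserving τ perm i j k c = sym (trans
  (cong (λ a → (u^ a · v^ deg-ξ b · q^ deg-x b · Q (Asc b)) i j k c) (Permuted.deg-θ≡asc τ perm)) (trans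
  (cong (λ a → (u^ asc τ · v^ a · q^ deg-x b · Q (Asc b)) i j k c) (Permuted.deg-ξ≡des τ perm)) (trans
  (cong (λ a → (u^ asc τ · v^ des τ · q^ a · Q (Asc b)) i j k c) (Permuted.deg-x≡sminv τ perm))
  (cong (λ a → (u^ asc τ · v^ des τ · q^ sminv τ · Q a) i j k c) (Permuted.Asc≡Split τ perm)))))
  where
  b = Letters.monomial τ

reindex : ∀ m → ∑ (B m) weightB ≈ ∑ (allSW m) (λ (kl , τ) → weightSW kl τ)
reindex m = ∑-reindex (SW→B m) (B→SW m) λ { {_ , τ} (_ , perm , refl , refl) → weight-preserving τ perm }

flatten : ∀ m → ∑ (allSW m) (λ (kl , τ) → weightSW kl τ)
              ≈ ∑ (SumBelow (suc m)) (λ (k , l) → ∑ (SW m k l) (weightSW (k , l)))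
flatten m = ∑-dependentProduct (λ (k , l) → SW m k l) weightSW (SumBelow (suc m))

unfactor : ∀ m → ∑ (SumBelow (suc m)) (λ (k , l) → ∑ (SW m k l) (weightSW (k , l)))
             ≈ (∑[ (k , l) ∈ SumBelow (suc m) ] u^ k · v^ l · ∑[ σ ∈ SW m k l ] q^ sminv σ · Q (Split σ))
unfactor m i j q c = sym (∑-cong (SumBelow (suc m)) (factor m) i j q c)

theorem6p6 : (m : ℕ) → let n = suc m in
    ∑[ b ∈ B m ] u^ deg-θ b · v^ deg-ξ b · q^ deg-x b · Q (Asc b)
    ≈
    ∑[ (k , l) ∈ SumBelow n ] u^ k · v^ l · ∑[ σ ∈ SW m k l ] q^ sminv σ · Q (Split σ)
theorem6p6 m i j k c = trans (reindex m i j k c) (trans (flatten m i j k c) (unfactor m i j k c))
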